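{- Let $n_1,\ldots,n_t$ be even positive integers and $n=\max\{n_1,\ldots,n_t\}$. Suppose that for each $1\leq i\leq t$ we have $n_i\geq 2\lceil \log (81^t n) \rceil+2$. Then for sufficiently large $n$, $$\hat{R}(C_{n_1},\ldots,C_{n_t})\leq 2\times 81^{2t} (t\ln 81+1)\, n.$$
   Context: $C_k$ denotes the cycle on $k$ vertices. For graphs $G_1,\ldots,G_k$, the size-Ramsey number $\hat{R}(G_1,\ldots,G_k)$ is the smallest integer $m$ for which there exists a graph $H$ with $m$ edges such that for every coloring of the edges of $H$ with colors $1,\ldots,k$ there is, for some $i$, a copy of $G_i$ in $H$ all of whose edges have color $i$. $\log$ denotes the logarithm to base $2$ and $\ln$ the natural logarithm. -}

module Defs where

open import Data.Fin.Base using (Fin; toℕ)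
import Data.Fin.Properties as Fin
open import Data.Integer.Base using (+_)
open import Data.List.Base using (List; allFin; cartesianProduct; filter; foldr; length; map; upTo)
open import Data.Nat.Base using (ℕ; zero; suc; _+_; _*_; _∸_; _≤_; _⊔_)
import Data.Nat.Properties as ℕ
open import Data.Product.Base using (∃-syntax; _×_; _,_; proj₁; proj₂)
open import Data.Rational.Base as ℚ using (ℚ; 0ℚ)
open import Data.Sum.Base using (_⊎_)
import Data.Sum.Base as Sum
import Data.Vec.Functional as Vector
open import Function.Base using (_∘_)
open import Function.Definitions using (Injective)
open import Level using (0ℓ)
open import Relation.Binary.Core using (Rel)
open import Relation.Binary.Definitions using (Decidable; Irreflexive; Symmetric)
open import Relation.Binary.PropositionalEquality using (_≡_; _≢_; sym)
open import Relation.Nullary.Decidable using (¬?; _×-dec_; _⊎-dec_)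

-- Finite simple graphs.

record Graph : Set₁ where
  field
    order      : ℕ
    Adj        : Rel (Fin order) 0ℓ
    adj?       : Decidable Adj
    adj-sym    : Symmetric Adj
    adj-irrefl : Irreflexive _≡_ Adj

  Vertex : Set
  Vertex = Fin order

  -- Each edge {u , v} is listed once, as the pair (u , v) with u < v.
  edges : List (Vertex × Vertex)
  edges = filter (λ (u , v) → (u Fin.<? v) ×-dec adj? u v)
                 (cartesianProduct (allFin order) (allFin order))

  size : ℕ
  size = length edges

open Graph

Next : ∀ {k} → Rel (Fin k) 0ℓ
Next {k} i j = (toℕ j ≡ suc (toℕ i)) ⊎ (suc (toℕ i) ≡ k × toℕ j ≡ 0)

next? : ∀ {k} → Decidable (Next {k})
next? {k} i j =
  (toℕ j ℕ.≟ suc (toℕ i)) ⊎-dec ((suc (toℕ i) ℕ.≟ k) ×-dec (toℕ j ℕ.≟ 0))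

-- The cycle C_k for k ≥ 3.  The condition i ≢ j only matters for k = 1, where
-- it removes a loop; for k < 3 the value (the complete graph) is a convention.
cycle : ℕ → Graph
cycle k = record
  { order      = k
  ; Adj        = λ i j → i ≢ j × (Next i j ⊎ Next j i)
  ; adj?       = λ i j → ¬? (i Fin.≟ j) ×-dec (next? i j ⊎-dec next? j i)
  ; adj-sym    = λ (i≢j , p) → i≢j ∘ sym , Sum.swap p
  ; adj-irrefl = λ i≡j (i≢j , _) → i≢j i≡j
  }

-- The adjacency argument is irrelevant, and both orientations of an edge get
-- the same colour, so this is a function on the set of edges.
record Colouring (H : Graph) (k : ℕ) : Set where
  field
    colour     : ∀ u v → .(Adj H u v) → Fin k
    colour-sym : ∀ u v .(e : Adj H u v) .(e′ : Adj H v u) →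
                 colour u v e ≡ colour v u e′

open Colouring

record MonochromaticCopy (G H : Graph) {k} (χ : Colouring H k) (c : Fin k) : Set where
  field
    embed           : Vertex G → Vertex H
    embed-injective : Injective _≡_ _≡_ embed
    embed-adj       : ∀ {u v} → Adj G u v → Adj H (embed u) (embed v)
    embed-colour    : ∀ {u v} (e : Adj G u v) →
                      colour χ (embed u) (embed v) (embed-adj e) ≡ c

infix 4 _⟶_

_⟶_ : ∀ {k} → Graph → (Fin k → Graph) → Set
_⟶_ {k} H G = (χ : Colouring H k) → ∃[ i ] MonochromaticCopy (G i) H χ i

-- m is the size-Ramsey number of the family G.
IsSizeRamsey : ∀ {k} → (Fin k → Graph) → ℕ → Set₁
IsSizeRamsey G m = (∃[ H ] (size H ≡ m × (H ⟶ G)))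
                 × (∀ H → H ⟶ G → m ≤ size H)

maximum : ∀ {t} → (Fin t → ℕ) → ℕ
maximum = Vector.foldr _⊔_ 0

fromℕ : ℕ → ℚ
fromℕ n = (+ n) ℚ./ 1

-- The upper Riemann sum of 1/x over [1 , a] for the partition into intervals
-- of length 1/(M+1): writing N = M + 1, it is the sum of 1/j for N ≤ j < a N.
upperSum : ℕ → ℕ → ℚ
upperSum a M =
  foldr ℚ._+_ 0ℚ (map (λ j → (+ 1) ℚ./ suc (M + j)) (upTo ((a ∸ 1) * suc M)))

-- ln a < q for a ≥ 1, where ln a = ∫₁ᵃ dx/x is the infimum of the upper sums.
-- The real number ln a is represented by its set of strict rational upper
-- bounds; for F continuous and nondecreasing, x ≤ F (ln a) holds exactly when
-- x ≤ F q for every rational q with ln a < q.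
ln_<_ : ℕ → ℚ → Set
ln a < q = ∃[ M ] (upperSum a M ℚ.< q)

infix 4 ln_<_

{-# OPTIONS --safe #-}
module Submission where

-- Let m₀ = ⌊n/2⌋ and K = 40ᵗ.  Choosing edges greedily, each one hitting at
-- least the fraction K⁻² of the pairs of m₀-subsets that are not yet joined,
-- gives a bipartite graph with parts of size K m₀ and the required number of
-- edges in which any two m₀-subsets on opposite sides are joined by an edge.
--
-- Colours are then eliminated one at a time.  Take a vertex set U with at least
-- 40 m vertices on each side.  If some subset of U with m vertices on each side
-- spans no edge of colour c, pass to it, at the cost of a factor 40; after t such
-- steps no colour is left, contradicting the choice of the graph.  Otherwise,
-- after removing few vertices from suitable parts of U, sets of at most m
-- vertices expand by a factor 4 in colour c, so balls with layers of sizes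
-- 1, 2, 4, … grow until a layer has m vertices.  Depth-first search gives a path
-- with any prescribed number of vertices up to 2 m; growing disjoint balls from
-- its ends and joining their last layers, which lie on opposite sides, closes an
-- even cycle of the required length.
--
-- The slack between 40 and 81 is so large that only ln 81 ≥ 0 is needed.

open import Defs
open import Data.Bool.Base using (Bool; true; false; not; _∧_)
import Data.Bool.Properties as Bool
open import Data.Fin.Base using (Fin; zero; suc; toℕ; fromℕ<; _↑ˡ_; _↑ʳ_; splitAt)
import Data.Fin.Properties as Fin
open import Data.Fin.Subset renaming (⊥ to ∅; ⊤ to full)
open import Data.Fin.Subset.Properties
open import Data.List.Base as List using (List; []; _∷_; length; allFin; cartesianProduct; upTo)
import Data.List.Properties as List
open import Data.Nat.Base using (ℕ; zero; suc; _+_; _*_; _^_; _∸_; _≤_; _<_; z≤n; s≤s; NonZero; >-nonZero; >-nonZero⁻¹; ⌊_/2⌋)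
open import Data.Nat.Divisibility using (_∣_; divides)
open import Data.Nat.Logarithm using (⌈log₂_⌉; ⌈log₂⌉-mono-≤; ⌈log₂2^n⌉≡n)
open import Data.Nat.Properties
open import Data.Nat.Tactic.RingSolver using (solve-∀)
open import Data.Product.Base using (∃; ∃₂; ∃-syntax; _×_; _,_; proj₁; proj₂)
open import Data.Rational.Base as ℚ using (ℚ)
open import Data.Sum.Base as Sum using (_⊎_; inj₁; inj₂; [_,_]′)
open import Data.Vec.Base as Vec using (Vec; []; _∷_; here; there)
import Data.Vec.Properties as Vec
open import Function.Base using (_∘_; id; case_of_)
open import Relation.Binary.PropositionalEquality
open import Relation.Nullary using (¬_; Dec; yes; no; does; contradiction)
open import Relation.Nullary.Decidable using (map′; _×-dec_; _⊎-dec_; _→-dec_; ¬?; dec-true; decidable-stable)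
open import Relation.Unary using (Decidable)
open import Data.List.Membership.Propositional using () renaming (_∈_ to _∈ᴸ_; _∉_ to _∉ᴸ_)
import Data.List.Membership.Propositional.Properties as Mem
open import Data.List.Relation.Unary.Any as Any using (here; there)
open import Data.List.Relation.Unary.All as All using ()
open import Data.List.Relation.Unary.AllPairs using ([]; _∷_)
open import Data.List.Relation.Unary.Unique.Propositional using (Unique)
import Data.List.Relation.Unary.Unique.Propositional.Properties as Unique
open import Data.Product.Properties using (≡-dec)
open import Relation.Binary.Definitions using (tri<; tri≈; tri>)
import Data.List.Relation.Unary.Any.Properties as Any
import Data.Integer.Base as ℤ
import Data.Integer.Properties as ℤ
import Data.Rational.Properties as ℚ
import Data.Rational.Unnormalised.Base as ℚᵘ
import Data.Rational.Unnormalised.Properties as ℚᵘ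
import Data.Nat.ListAction as ListAction
import Data.Nat.ListAction.Properties as ListAction

-- In units of `m`, the constant 40 is 8 + 16 + 16: each of the two balls lives in an expanding set
-- cut out of 16 `m` vertices per side, and the path lives in the rest. The balls are needed because
-- the absence of holes gives edges only between sets of at least `m` vertices, so the two ends of
-- the path must first be blown up to that size. Bipartiteness determines the side of each last
-- layer by parity, so the length of the cycle is exact: 2 (d + 1) + 2 j for radius `d` and a path
-- on 2 j vertices.
--
-- This explains the hypotheses. Since nᵢ ≤ n and m₀ = ⌊n/2⌋, the path has at most 2 m₀ ≤ 2 m
-- vertices. The radius satisfies 2^(d+1) ≤ 4 m ≤ 81ᵗ n, so the lower bound on nᵢ leaves j ≥ 1.
--
-- The size-Ramsey number is an attained minimum, which a constructive proof has to produce: the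
-- arrow relation is decided by exhaustive search, after the graphs with a given number of edges
-- have been reduced to finitely many candidates.

private
  variable
    n : ℕ

-- Finite subsets

∣p∪q∣≤∣p∣+∣q∣ : (p q : Subset n) → ∣ p ∪ q ∣ ≤ ∣ p ∣ + ∣ q ∣
∣p∪q∣≤∣p∣+∣q∣ []          []          = z≤n
∣p∪q∣≤∣p∣+∣q∣ (false ∷ p) (false ∷ q) = ∣p∪q∣≤∣p∣+∣q∣ p q
∣p∪q∣≤∣p∣+∣q∣ (true  ∷ p) (false ∷ q) = s≤s (∣p∪q∣≤∣p∣+∣q∣ p q)
∣p∪q∣≤∣p∣+∣q∣ (false ∷ p) (true  ∷ q) =
  ≤-trans (s≤s (∣p∪q∣≤∣p∣+∣q∣ p q)) (≤-reflexive (sym (+-suc ∣ p ∣ ∣ q ∣)))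
∣p∪q∣≤∣p∣+∣q∣ (true  ∷ p) (true  ∷ q) =
  s≤s (≤-trans (∣p∪q∣≤∣p∣+∣q∣ p q) (+-monoʳ-≤ ∣ p ∣ (n≤1+n ∣ q ∣)))

Disjoint : Subset n → Subset n → Set
Disjoint p q = ∀ {x} → x ∈ p → x ∉ q

∣p∪q∣≡∣p∣+∣q∣ : (p q : Subset n) → Disjoint p q → ∣ p ∪ q ∣ ≡ ∣ p ∣ + ∣ q ∣
∣p∪q∣≡∣p∣+∣q∣ []          []          p#q = refl
∣p∪q∣≡∣p∣+∣q∣ (false ∷ p) (false ∷ q) p#q =
  ∣p∪q∣≡∣p∣+∣q∣ p q (λ a b → p#q (there a) (there b))
∣p∪q∣≡∣p∣+∣q∣ (true  ∷ p) (false ∷ q) p#q =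
  cong suc (∣p∪q∣≡∣p∣+∣q∣ p q (λ a b → p#q (there a) (there b)))
∣p∪q∣≡∣p∣+∣q∣ (false ∷ p) (true  ∷ q) p#q =
  trans (cong suc (∣p∪q∣≡∣p∣+∣q∣ p q (λ a b → p#q (there a) (there b))))
        (sym (+-suc ∣ p ∣ ∣ q ∣))
∣p∪q∣≡∣p∣+∣q∣ (true  ∷ p) (true  ∷ q) p#q = contradiction here (p#q here)

x∈p─q⇒x∉q : (p q : Subset n) → ∀ {x} → x ∈ p ─ q → x ∉ q
x∈p─q⇒x∉q (_ ∷ p) (true ∷ q) (there x∈) (there x∈q) = x∈p─q⇒x∉q p q x∈ x∈q
x∈p─q⇒x∉q (_ ∷ p) (false ∷ q) (there x∈) (there x∈q) = x∈p─q⇒x∉q p q x∈ x∈q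

⊆∪⇒∣∣≤ : (p q r : Subset n) → p ⊆ q ∪ r → ∣ p ∣ ≤ ∣ q ∣ + ∣ r ∣
⊆∪⇒∣∣≤ p q r p⊆ = ≤-trans (p⊆q⇒∣p∣≤∣q∣ p⊆) (∣p∪q∣≤∣p∣+∣q∣ q r)

∣p∣≤∣p∩q∣+∣p─q∣ : (p q : Subset n) → ∣ p ∣ ≤ ∣ p ∩ q ∣ + ∣ p ─ q ∣
∣p∣≤∣p∩q∣+∣p─q∣ p q = ⊆∪⇒∣∣≤ p (p ∩ q) (p ─ q) p⊆
  where
  p⊆ : p ⊆ (p ∩ q) ∪ (p ─ q)
  p⊆ {x} x∈p with x ∈? q
  ... | yes x∈q = x∈p∪q⁺ (inj₁ (x∈p∩q⁺ (x∈p , x∈q)))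
  ... | no  x∉q = x∈p∪q⁺ (inj₂ (x∈p∧x∉q⇒x∈p─q x∈p x∉q))

∣p∣≤∣p─q∣+∣q∣ : (p q : Subset n) → ∣ p ∣ ≤ ∣ p ─ q ∣ + ∣ q ∣
∣p∣≤∣p─q∣+∣q∣ p q = begin
  ∣ p ∣                   ≤⟨ ∣p∣≤∣p∩q∣+∣p─q∣ p q ⟩
  ∣ p ∩ q ∣ + ∣ p ─ q ∣  ≤⟨ +-monoˡ-≤ ∣ p ─ q ∣ (∣p∩q∣≤∣q∣ p q) ⟩
  ∣ q ∣ + ∣ p ─ q ∣      ≡⟨ +-comm ∣ q ∣ ∣ p ─ q ∣ ⟩
  ∣ p ─ q ∣ + ∣ q ∣      ∎
  where open ≤-Reasoning

1≤∣p∣⇒Nonempty : (p : Subset n) → 1 ≤ ∣ p ∣ → Nonempty p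
1≤∣p∣⇒Nonempty {n} p 1≤ with nonempty? p
... | yes ne = ne
... | no ¬ne = contradiction (subst (λ r → 1 ≤ ∣ r ∣) (Empty-unique ¬ne) 1≤)
                             (λ 1≤0 → case subst (1 ≤_) (∣⊥∣≡0 n) 1≤0 of λ ())

subset-of-size : (p : Subset n) → ∀ k → k ≤ ∣ p ∣ → ∃[ q ] (q ⊆ p × ∣ q ∣ ≡ k)
subset-of-size {n} p zero _ = ∅ , ⊥⊆ , ∣⊥∣≡0 n
subset-of-size (false ∷ p) (suc k) k≤ =
  let q , q⊆p , ∣q∣ = subset-of-size p (suc k) k≤ in false ∷ q , out⊆ q⊆p , ∣q∣
subset-of-size (true ∷ p) (suc k) (s≤s k≤) =
  let q , q⊆p , ∣q∣ = subset-of-size p k k≤ in true ∷ q , in⊆in q⊆p , cong suc ∣q∣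

select : {P : Fin n → Set} → Decidable P → Subset n
select P? = Vec.tabulate (does ∘ P?)

module _ {P : Fin n → Set} (P? : Decidable P) where

  ∈-select⁺ : ∀ {x} → P x → x ∈ select P?
  ∈-select⁺ {x} px = Vec.lookup⇒[]= x (select P?)
    (trans (Vec.lookup∘tabulate (does ∘ P?) x) (dec-true (P? x) px))

  ∈-select⁻ : ∀ {x} → x ∈ select P? → P x
  ∈-select⁻ {x} x∈ with P? x
                      | trans (sym (Vec.lookup∘tabulate (does ∘ P?) x)) (Vec.[]=⇒lookup x∈)
  ... | yes px | _ = px
  ... | no  _  | ()

-- Simple paths

module Paths {n} (E : Fin n → Fin n → Set) where

  data Path : Fin n → Fin n → List (Fin n) → Set where
    [_]  : ∀ x → Path x x (x ∷ [])
    cons : ∀ {x y z vs} → E x y → x ∉ᴸ vs → Path y z vs → Path x z (x ∷ vs)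

  head∈ : ∀ {x y vs} → Path x y vs → x ∈ᴸ vs
  head∈ [ x ]        = here refl
  head∈ (cons _ _ _) = here refl

  last∈ : ∀ {x y vs} → Path x y vs → y ∈ᴸ vs
  last∈ [ x ]        = here refl
  last∈ (cons _ _ p) = there (last∈ p)

  -- The two paths are joined at their heads, so the first one has to be reversed; its vertices move
  -- over one at a time, as in `ʳ++`.
  glue : (∀ {x y} → E x y → E y x) →
         ∀ {x y u v us vs} → Path x y us → Path u v vs → E x u →
         (∀ {w} → w ∈ᴸ us → w ∉ᴸ vs) → Path y v (us List.ʳ++ vs)
  glue E-sym [ x ] q xu us#vs = cons xu (us#vs (here refl)) q
  glue E-sym (cons xy x∉us p) q xu us#vs =
    glue E-sym p (cons xu (us#vs (here refl)) q) (E-sym xy)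
      λ { w∈ (here refl) → x∉us w∈ ; w∈ (there w∈vs) → us#vs (there w∈) w∈vs }

  append : ∀ {x y u v us vs} → Path x y us → Path u v vs → E y u →
           (∀ {w} → w ∈ᴸ us → w ∉ᴸ vs) → Path x v (us List.++ vs)
  append [ x ] q yu us#vs = cons yu (us#vs (here refl)) q
  append (cons {vs = us} xy x∉us p) q yu us#vs =
    cons xy ([ x∉us , us#vs (here refl) ]′ ∘ Mem.∈-++⁻ us)
         (append p q yu (us#vs ∘ there))

  lookup-injective : ∀ {x y vs} → Path x y vs → ∀ {i j} →
                     List.lookup vs i ≡ List.lookup vs j → i ≡ j
  lookup-injective [ x ] {zero} {zero} eq = refl
  lookup-injective (cons _ _ _) {zero} {zero} eq = refl
  lookup-injective (cons {vs = vs} _ x∉ p) {zero} {suc j} eq =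
    contradiction (subst (_∈ᴸ vs) (sym eq) (Mem.∈-lookup j)) x∉
  lookup-injective (cons {vs = vs} _ x∉ p) {suc i} {zero} eq =
    contradiction (subst (_∈ᴸ vs) eq (Mem.∈-lookup i)) x∉
  lookup-injective (cons _ _ p) {suc i} {suc j} eq = cong suc (lookup-injective p eq)

  lookup-first : ∀ {x y vs} → Path x y vs → ∀ i → toℕ i ≡ 0 → List.lookup vs i ≡ x
  lookup-first [ x ]        zero _ = refl
  lookup-first (cons _ _ _) zero _ = refl

  lookup-last : ∀ {x y vs} → Path x y vs → ∀ i → suc (toℕ i) ≡ length vs →
                List.lookup vs i ≡ y
  lookup-last [ x ]        zero    _  = refl
  lookup-last (cons _ _ p) (suc i) eq = lookup-last p i (suc-injective eq)
  lookup-last (cons _ _ [ _ ])        zero ()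
  lookup-last (cons _ _ (cons _ _ _)) zero ()

  lookup-next : ∀ {x y vs} → Path x y vs → ∀ i j → toℕ j ≡ suc (toℕ i) →
                E (List.lookup vs i) (List.lookup vs j)
  lookup-next (cons {x} xy _ p) zero (suc j) eq =
    subst (E x) (sym (lookup-first p j (suc-injective eq))) xy
  lookup-next (cons _ _ p) (suc i) (suc j) eq = lookup-next p i j (suc-injective eq)
  lookup-next [ x ] zero (suc ()) eq
  lookup-next [ x ] (suc ()) _ eq

  CycleOfLength : ℕ → Set
  CycleOfLength k = ∃ λ (f : Fin k → Fin n) →
    (∀ {i j} → f i ≡ f j → i ≡ j) × (∀ {i j} → Graph.Adj (cycle k) i j → E (f i) (f j))

  close-path : (∀ {x y} → E x y → E y x) →
               ∀ {x y vs} → Path x y vs → E y x → CycleOfLength (length vs)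
  close-path E-sym {vs = vs} p yx = List.lookup vs , lookup-injective p , adj
    where
    next : ∀ {i j} → Next i j → E (List.lookup vs i) (List.lookup vs j)
    next {i} {j} (inj₁ eq)         = lookup-next p i j eq
    next {i} {j} (inj₂ (eq₁ , eq₂)) =
      subst₂ E (sym (lookup-last p i eq₁)) (sym (lookup-first p j eq₂)) yx

    adj : ∀ {i j} → Graph.Adj (cycle (length vs)) i j → E (List.lookup vs i) (List.lookup vs j)
    adj (_ , inj₁ i→j) = next i→j
    adj (_ , inj₂ j→i) = E-sym (next j→i)

-- The side on which a walk with `k` edges ends in a bipartite graph if it starts on side `b`.
alternate : ℕ → Bool → Bool
alternate zero    b = b
alternate (suc k) b = not (alternate k b)

alternate-not : ∀ k b → alternate k (not b) ≡ not (alternate k b)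
alternate-not zero    b = refl
alternate-not (suc k) b = cong not (alternate-not k b)

alternate-even : ∀ k b → alternate (k + k) b ≡ b
alternate-even zero    b = refl
alternate-even (suc k) b = begin
  not (alternate (k + suc k) b)   ≡⟨ cong (λ j → not (alternate j b)) (+-suc k k) ⟩
  not (not (alternate (k + k) b)) ≡⟨ Bool.not-involutive _ ⟩
  alternate (k + k) b             ≡⟨ alternate-even k b ⟩
  b                               ∎
  where open ≡-Reasoning

-- The monochromatic bipartite graph

fromList : List (Fin n) → Subset n
fromList = List.foldr (λ x p → ⁅ x ⁆ ∪ p) ∅

∣fromList∣≤length : (xs : List (Fin n)) → ∣ fromList xs ∣ ≤ length xs
∣fromList∣≤length {n} []   = ≤-reflexive (∣⊥∣≡0 n)
∣fromList∣≤length (x ∷ xs) = ≤-trans (∣p∪q∣≤∣p∣+∣q∣ ⁅ x ⁆ (fromList xs))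
  (+-mono-≤ (≤-reflexive (∣⁅x⁆∣≡1 x)) (∣fromList∣≤length xs))

∈-fromList : ∀ {x} {xs : List (Fin n)} → x ∈ᴸ xs → x ∈ fromList xs
∈-fromList {x = x} (here refl) = x∈p∪q⁺ (inj₁ (x∈⁅x⁆ x))
∈-fromList (there x∈) = x∈p∪q⁺ (inj₂ (∈-fromList x∈))

module Sides {n} (side : Fin n → Bool) where

  on? : ∀ b → Decidable (λ x → side x ≡ b)
  on? b x = side x Bool.≟ b

  part : Bool → Subset n → Subset n
  part b W = W ∩ select (on? b)

  ∈-part⁺ : ∀ {b W x} → x ∈ W → side x ≡ b → x ∈ part b W
  ∈-part⁺ {b} x∈W sx = x∈p∩q⁺ (x∈W , ∈-select⁺ (on? b) sx)

  ∈-part⁻ : ∀ {b W x} → x ∈ part b W → x ∈ W × side x ≡ b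
  ∈-part⁻ {b} {W} x∈ = let x∈W , x∈b = x∈p∩q⁻ W _ x∈ in x∈W , ∈-select⁻ (on? b) x∈b

  part-mono : ∀ {b V W} → V ⊆ W → part b V ⊆ part b W
  part-mono V⊆W x∈ = let x∈V , sx = ∈-part⁻ x∈ in ∈-part⁺ (V⊆W x∈V) sx

  ∣part∣≤∣part─∣+∣part∣ : ∀ b W R → ∣ part b W ∣ ≤ ∣ part b (W ─ R) ∣ + ∣ part b R ∣
  ∣part∣≤∣part─∣+∣part∣ b W R = ⊆∪⇒∣∣≤ (part b W) (part b (W ─ R)) (part b R) split
    where
    split : part b W ⊆ part b (W ─ R) ∪ part b R
    split {x} x∈ with ∈-part⁻ x∈ | x ∈? R
    ... | x∈W , sx | yes x∈R = x∈p∪q⁺ (inj₂ (∈-part⁺ x∈R sx))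
    ... | x∈W , sx | no  x∉R = x∈p∪q⁺ (inj₁ (∈-part⁺ (x∈p∧x∉q⇒x∈p─q x∈W x∉R) sx))

  -- Exact sizes matter here: removing `V` afterwards costs each side of `W` a known number of
  -- vertices.
  subset-with-parts : ∀ W k → (∀ b → k ≤ ∣ part b W ∣) → ∃[ V ] (V ⊆ W × ∀ b → ∣ part b V ∣ ≡ k)
  subset-with-parts W k large = V , V⊆W , λ b → trans (cong ∣_∣ (part-V b)) (proj₂ (proj₂ (q b)))
    where
    q : ∀ b → ∃[ Q ] (Q ⊆ part b W × ∣ Q ∣ ≡ k)
    q b = subset-of-size (part b W) k (large b)

    V = proj₁ (q true) ∪ proj₁ (q false)

    q⊆V : ∀ b → proj₁ (q b) ⊆ V
    q⊆V true  x∈ = x∈p∪q⁺ (inj₁ x∈)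
    q⊆V false x∈ = x∈p∪q⁺ (inj₂ x∈)

    V⊆q : ∀ {x} → x ∈ V → x ∈ proj₁ (q (side x))
    V⊆q {x} x∈ with x∈p∪q⁻ (proj₁ (q true)) (proj₁ (q false)) x∈
    ... | inj₁ x∈q = subst (λ b → x ∈ proj₁ (q b)) (sym (proj₂ (∈-part⁻ (proj₁ (proj₂ (q true)) x∈q)))) x∈q
    ... | inj₂ x∈q = subst (λ b → x ∈ proj₁ (q b)) (sym (proj₂ (∈-part⁻ (proj₁ (proj₂ (q false)) x∈q)))) x∈q

    V⊆W : V ⊆ W
    V⊆W {x} x∈ = proj₁ (∈-part⁻ (proj₁ (proj₂ (q (side x))) (V⊆q x∈)))

    part-V : ∀ b → part b V ≡ proj₁ (q b)
    part-V b = ⊆-antisym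
      (λ {x} x∈ → let x∈V , sx = ∈-part⁻ x∈ in subst (λ c → x ∈ proj₁ (q c)) sx (V⊆q x∈V))
      (λ x∈ → ∈-part⁺ (q⊆V b x∈) (proj₂ (∈-part⁻ (proj₁ (proj₂ (q b)) x∈))))

  big-part : ∀ {k} R → k + k ≤ ∣ R ∣ → ∃[ b ] k ≤ ∣ part b R ∣
  big-part {k} R k+k≤ with k ≤? ∣ part true R ∣ | k ≤? ∣ part false R ∣
  ... | yes k≤ | _      = true , k≤
  ... | _      | yes k≤ = false , k≤
  ... | no k≰₁ | no k≰₂ = contradiction k+k≤ (<⇒≱ (begin-strict
    ∣ R ∣                                 ≤⟨ ⊆∪⇒∣∣≤ R (part true R) (part false R) split ⟩
    ∣ part true R ∣ + ∣ part false R ∣   <⟨ +-mono-< (≰⇒> k≰₁) (≰⇒> k≰₂) ⟩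
    k + k                                 ∎))
    where
    open ≤-Reasoning
    split : R ⊆ part true R ∪ part false R
    split {x} x∈R with side x in sx
    ... | true  = x∈p∪q⁺ (inj₁ (∈-part⁺ x∈R sx))
    ... | false = x∈p∪q⁺ (inj₂ (∈-part⁺ x∈R sx))

-- Holes, expansion and balls in a bipartite graph

module Crossing {n} (side : Fin n → Bool) (E : Fin n → Fin n → Set)
                (E? : ∀ x y → Dec (E x y)) (E-sym : ∀ {x y} → E x y → E y x)
                (E-cross : ∀ {x y} → E x y → side x ≡ not (side y)) where

  open Paths E
  open Sides side

  same-side⇒¬E : ∀ {x y b} → side x ≡ b → side y ≡ b → ¬ E x y
  same-side⇒¬E sx sy xy =
    Bool.not-¬ {side _} refl (trans (trans sy (sym sx)) (E-cross xy))

  nbr? : ∀ X → Decidable (λ y → ∃[ x ] (x ∈ X × E x y))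
  nbr? X y = Fin.any? (λ x → (x ∈? X) ×-dec E? x y)

  nbr : Subset n → Subset n
  nbr X = select (nbr? X)

  ∈-nbr⁺ : ∀ {X x y} → x ∈ X → E x y → y ∈ nbr X
  ∈-nbr⁺ {X} x∈X xy = ∈-select⁺ (nbr? X) (_ , x∈X , xy)

  ∈-nbr⁻ : ∀ {X y} → y ∈ nbr X → ∃[ x ] (x ∈ X × E x y)
  ∈-nbr⁻ {X} y∈ = ∈-select⁻ (nbr? X) y∈

  -- Stated for one set `W` meeting both sides rather than for a pair of sets, so that a failure is
  -- a single subset: the one to which the elimination of a colour passes.
  HoleFree : ℕ → Subset n → Set
  HoleFree m U = ∀ W → W ⊆ U → (∀ b → m ≤ ∣ part b W ∣) → ∃₂ λ x y → x ∈ W × y ∈ W × E x y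

  -- The factor 4 is what `grow` consumes: of at least 4 * 2^i neighbours of a layer, at most 2 *
  -- 2^i lie in the ball already, which leaves 2^(i+1) for the next layer.
  Expanding : ℕ → Subset n → Set
  Expanding m W = ∀ X → X ⊆ W → ∣ X ∣ ≤ m → 4 * ∣ X ∣ ≤ ∣ (nbr X ∩ W) ─ X ∣

  -- Not a full metric ball: each layer is trimmed to exactly 2^i vertices, which keeps the whole
  -- ball below a geometric sum. The paths to the centre all have `suc i` vertices, so the last
  -- layer lies on one side.
  record Ball (W : Subset n) (x₀ : Fin n) (i : ℕ) : Set where
    field
      layer ball : Subset n
      ball⊆      : ball ⊆ W
      layer⊆     : layer ⊆ ball
      ∣layer∣    : ∣ layer ∣ ≡ 2 ^ i
      ∣ball∣     : ∣ ball ∣ ≤ 2 * 2 ^ i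
      to-centre  : ∀ {w} → w ∈ layer →
        ∃[ us ] (Path w x₀ us × length us ≡ suc i × (∀ {u} → u ∈ᴸ us → u ∈ ball))

  -- Expansion is applied only to the layers before the last, so only these must have at most `m`
  -- vertices; the last one may be larger.
  grow : ∀ {m W x₀} → Expanding m W → x₀ ∈ W → ∀ i → (∀ {j} → j < i → 2 ^ j ≤ m) → Ball W x₀ i
  grow {x₀ = x₀} exp x₀∈W zero _ = record
    { layer = ⁅ x₀ ⁆ ; ball = ⁅ x₀ ⁆
    ; ball⊆ = λ x∈ → subst (_∈ _) (sym (x∈⁅y⁆⇒x≡y x₀ x∈)) x₀∈W
    ; layer⊆ = id
    ; ∣layer∣ = ∣⁅x⁆∣≡1 x₀
    ; ∣ball∣ = subst (_≤ 2) (sym (∣⁅x⁆∣≡1 x₀)) (s≤s z≤n)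
    ; to-centre = λ {w} w∈ → case x∈⁅y⁆⇒x≡y x₀ w∈ of λ
        { refl → (x₀ ∷ []) , [ x₀ ] , refl , λ { (here refl) → x∈⁅x⁆ x₀ } }
    }
  grow {m} {W} {x₀} exp x₀∈W (suc i) small = record
    { layer = L′ ; ball = B ∪ L′
    ; ball⊆ = λ x∈ → [ B⊆W , (λ x∈L′ → proj₁ (fresh x∈L′)) ]′ (x∈p∪q⁻ B L′ x∈)
    ; layer⊆ = λ x∈ → x∈p∪q⁺ (inj₂ x∈)
    ; ∣layer∣ = ∣L′∣
    ; ∣ball∣ = begin
        ∣ B ∪ L′ ∣                ≤⟨ ∣p∪q∣≤∣p∣+∣q∣ B L′ ⟩
        ∣ B ∣ + ∣ L′ ∣            ≤⟨ +-mono-≤ ∣B∣ (≤-reflexive ∣L′∣) ⟩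
        2 * 2 ^ i + 2 ^ suc i     ≡⟨ lem₁ (2 ^ i) ⟩
        2 * 2 ^ suc i             ∎
    ; to-centre = λ w∈ → let _ , w∉B , u , u∈L , uw = fresh w∈
                             us , p , len , us⊆ = L→x₀ u∈L
                         in _ ∷ us , cons (E-sym uw) (w∉B ∘ us⊆) p , cong suc len , λ
                           { (here refl) → x∈p∪q⁺ (inj₂ w∈)
                           ; (there u∈us) → x∈p∪q⁺ (inj₁ (us⊆ u∈us)) }
    }
    where
    open ≤-Reasoning
    open Ball (grow exp x₀∈W i (λ j<i → small (m≤n⇒m≤1+n j<i)))
      renaming (layer to L; ball to B; ball⊆ to B⊆W; layer⊆ to L⊆B; ∣layer∣ to ∣L∣; ∣ball∣ to ∣B∣; to-centre to L→x₀)

    lem₁ : ∀ a → 2 * a + 2 * a ≡ 2 * (2 * a)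
    lem₁ = solve-∀
    lem₂ : ∀ a → 2 * a + 2 * a ≡ 4 * a
    lem₂ = solve-∀

    Z : Subset n
    Z = ((nbr L ∩ W) ─ L) ─ B

    2^1+i≤∣Z∣ : 2 ^ suc i ≤ ∣ Z ∣
    2^1+i≤∣Z∣ = +-cancelʳ-≤ (2 * 2 ^ i) _ _ (begin
      2 * 2 ^ i + 2 * 2 ^ i    ≡⟨ lem₂ (2 ^ i) ⟩
      4 * 2 ^ i                ≡⟨ cong (4 *_) (sym ∣L∣) ⟩
      4 * ∣ L ∣                ≤⟨ exp L (B⊆W ∘ L⊆B) (≤-trans (≤-reflexive ∣L∣) (small ≤-refl)) ⟩
      ∣ (nbr L ∩ W) ─ L ∣      ≤⟨ ∣p∣≤∣p─q∣+∣q∣ ((nbr L ∩ W) ─ L) B ⟩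
      ∣ Z ∣ + ∣ B ∣            ≤⟨ +-monoʳ-≤ ∣ Z ∣ ∣B∣ ⟩
      ∣ Z ∣ + 2 * 2 ^ i        ∎)

    chosen = subset-of-size Z (2 ^ suc i) 2^1+i≤∣Z∣
    L′ = proj₁ chosen
    ∣L′∣ = proj₂ (proj₂ chosen)

    fresh : ∀ {x} → x ∈ L′ → x ∈ W × x ∉ B × ∃[ u ] (u ∈ L × E u x)
    fresh x∈L′ = let x∈Z = proj₁ (proj₂ chosen) x∈L′
                     x∈N , x∈W = x∈p∩q⁻ (nbr L) W (p─q⊆p (nbr L ∩ W) L (p─q⊆p _ B x∈Z))
                 in x∈W , x∈p─q⇒x∉q _ B x∈Z , ∈-nbr⁻ x∈N

  -- The list counts vertices, one more than the edges; the negation on the left makes up for this.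
  path-parity : ∀ {x y vs} → Path x y vs → not (side x) ≡ alternate (length vs) (side y)
  path-parity [ x ] = refl
  path-parity (cons xy _ p) = cong not (trans (E-cross xy) (path-parity p))

  module HoleFreeSet {m U} (1≤m : 1 ≤ m) (hole-free : HoleFree m U) where

    -- Absence of holes is applied to `X ∪ Y`; the edge found cannot lie inside `X` or inside `Y`,
    -- as each of them is contained in one side.
    edge-between : ∀ b {X Y} → X ⊆ part b U → Y ⊆ part (not b) U → m ≤ ∣ X ∣ → m ≤ ∣ Y ∣ →
                   ∃₂ λ x y → x ∈ X × y ∈ Y × E x y
    edge-between b {X} {Y} X⊆ Y⊆ m≤X m≤Y
      with hole-free (X ∪ Y) (λ x∈ → [ proj₁ ∘ ∈-part⁻ ∘ X⊆ , proj₁ ∘ ∈-part⁻ ∘ Y⊆ ]′ (x∈p∪q⁻ X Y x∈)) large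
      where
      large : ∀ c → m ≤ ∣ part c (X ∪ Y) ∣
      large c with c Bool.≟ b
      ... | yes refl = ≤-trans m≤X (p⊆q⇒∣p∣≤∣q∣ {q = part c (X ∪ Y)} λ x∈ →
                         ∈-part⁺ (x∈p∪q⁺ (inj₁ x∈)) (proj₂ (∈-part⁻ (X⊆ x∈))))
      ... | no  c≢b  = ≤-trans m≤Y (p⊆q⇒∣p∣≤∣q∣ {q = part c (X ∪ Y)} λ x∈ →
                         ∈-part⁺ (x∈p∪q⁺ (inj₂ x∈))
                                 (trans (proj₂ (∈-part⁻ (Y⊆ x∈))) (sym (Bool.¬-not c≢b))))
    ... | x , y , x∈ , y∈ , xy with x∈p∪q⁻ X Y x∈ | x∈p∪q⁻ X Y y∈
    ... | inj₁ x∈X | inj₂ y∈Y = x , y , x∈X , y∈Y , xy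
    ... | inj₂ x∈Y | inj₁ y∈X = y , x , y∈X , x∈Y , E-sym xy
    ... | inj₁ x∈X | inj₁ y∈X =
      contradiction xy (same-side⇒¬E (proj₂ (∈-part⁻ (X⊆ x∈X))) (proj₂ (∈-part⁻ (X⊆ y∈X))))
    ... | inj₂ x∈Y | inj₂ y∈Y =
      contradiction xy (same-side⇒¬E (proj₂ (∈-part⁻ (Y⊆ x∈Y))) (proj₂ (∈-part⁻ (Y⊆ y∈Y))))

    -- The exceptional vertices on side `b` span no edge with the opposite part of `Z`, so `m` of
    -- them would form a hole.
    few-without-neighbours : ∀ {V Z} → V ⊆ U → Z ⊆ U → (∀ b → m ≤ ∣ part b Z ∣) → ∀ b →
                             ∣ part b V ∣ ≤ ∣ part b (V ∩ nbr Z) ∣ + m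
    few-without-neighbours {V} {Z} V⊆U Z⊆U large b = begin
      ∣ part b V ∣                                          ≤⟨ ⊆∪⇒∣∣≤ (part b V) (part b (V ∩ nbr Z)) I split ⟩
      ∣ part b (V ∩ nbr Z) ∣ + ∣ I ∣                        ≤⟨ +-monoʳ-≤ _ few ⟩
      ∣ part b (V ∩ nbr Z) ∣ + m                            ∎
      where
      open ≤-Reasoning
      I = part b (V ─ nbr Z)

      few : ∣ I ∣ ≤ m
      few with m ≤? ∣ I ∣
      ... | no  m≰ = <⇒≤ (≰⇒> m≰)
      ... | yes m≤ with edge-between b (part-mono (V⊆U ∘ p─q⊆p V _)) (part-mono Z⊆U) m≤ (large (not b))
      ...   | x , y , x∈I , y∈Z , xy =
        contradiction (∈-nbr⁺ (proj₁ (∈-part⁻ y∈Z)) (E-sym xy))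
                      (x∈p─q⇒x∉q V _ (proj₁ (∈-part⁻ x∈I)))

      split : part b V ⊆ part b (V ∩ nbr Z) ∪ I
      split {x} x∈ with ∈-part⁻ x∈ | x ∈? nbr Z
      ... | x∈V , sx | yes x∈N = x∈p∪q⁺ (inj₁ (∈-part⁺ (x∈p∩q⁺ (x∈V , x∈N)) sx))
      ... | x∈V , sx | no  x∉N = x∈p∪q⁺ (inj₂ (∈-part⁺ (x∈p∧x∉q⇒x∈p─q x∈V x∉N) sx))

    -- Sets that fail to expand are moved one after another into `R`, whose outer boundary stays at
    -- most 4 times its size. Each has at most `m` vertices, so if `R` ever reached 2 m vertices it
    -- would still have at most 3 m, and `not-too-large` would give a contradiction.
    hole-free⇒expanding : ∀ {W} → W ⊆ U → (∀ b → 16 * m ≤ ∣ part b W ∣) →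
      ∃[ W′ ] (W′ ⊆ W × (∀ b → m ≤ ∣ part b W′ ∣) × Expanding m W′)
    hole-free⇒expanding {W} W⊆U large =
      let R , ∣R∣< , exp = prune (m + m) ∅ ⊥⊆ (subst (_< m + m) (sym (∣⊥∣≡0 n)) (+-mono-≤ 1≤m z≤n))
                                 (≤-trans (p⊆q⇒∣p∣≤∣q∣ {q = ∅} λ x∈ →
                                   contradiction (proj₁ (proj₂ (∈-nbr⁻ (proj₁ (x∈p∩q⁻ (nbr ∅) _ x∈))))) ∉⊥)
                                   (m≤n*m ∣ ∅ {n} ∣ 4))
                                 (m≤m+n (m + m) _)
      in W ─ R , p─q⊆p W R , (λ b → rest R ∣R∣< b) , exp
      where
      open ≤-Reasoning

      ∂ : Subset n → Subset n
      ∂ R = nbr R ∩ (W ─ R)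

      lem₁ : ∀ m → m + (m + m + m + 4 * (m + m + m)) ≡ 16 * m
      lem₁ = solve-∀
      lem₂ : ∀ m → m + (m + m) + 13 * m ≡ 16 * m
      lem₂ = solve-∀

      -- One side of `R` has `m` vertices. Away from `R` and its boundary the opposite side of `W`
      -- keeps 16 m - 3 m - 12 m = m vertices, and no edge joins the two sets. This is the origin of
      -- the constant 16.
      not-too-large : ∀ R → R ⊆ W → m + m ≤ ∣ R ∣ → ∣ R ∣ ≤ m + m + m → ¬ (∣ ∂ R ∣ ≤ 4 * ∣ R ∣)
      not-too-large R R⊆W 2m≤ ≤3m ∂≤ =
        let b , m≤ = big-part R 2m≤
            Y = part (not b) W ─ (R ∪ ∂ R)
            m≤Y : m ≤ ∣ Y ∣
            m≤Y = +-cancelʳ-≤ (m + m + m + 4 * (m + m + m)) m ∣ Y ∣ (begin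
              m + (m + m + m + 4 * (m + m + m))    ≡⟨ lem₁ m ⟩
              16 * m                               ≤⟨ large (not b) ⟩
              ∣ part (not b) W ∣                   ≤⟨ ∣p∣≤∣p─q∣+∣q∣ (part (not b) W) (R ∪ ∂ R) ⟩
              ∣ Y ∣ + ∣ R ∪ ∂ R ∣                  ≤⟨ +-monoʳ-≤ ∣ Y ∣ (∣p∪q∣≤∣p∣+∣q∣ R (∂ R)) ⟩
              ∣ Y ∣ + (∣ R ∣ + ∣ ∂ R ∣)            ≤⟨ +-monoʳ-≤ ∣ Y ∣ (+-mono-≤ ≤3m (≤-trans ∂≤ (*-monoʳ-≤ 4 ≤3m))) ⟩
              ∣ Y ∣ + (m + m + m + 4 * (m + m + m)) ∎)
            x , y , x∈ , y∈Y , xy = edge-between b (part-mono (W⊆U ∘ R⊆W))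
                                      (part-mono W⊆U ∘ p─q⊆p _ (R ∪ ∂ R)) m≤ m≤Y
            y∉ = x∈p─q⇒x∉q _ (R ∪ ∂ R) y∈Y
            y∈W = proj₁ (∈-part⁻ (p─q⊆p _ (R ∪ ∂ R) y∈Y))
        in y∉ (x∈p∪q⁺ (inj₂ (x∈p∩q⁺ (∈-nbr⁺ (proj₁ (∈-part⁻ x∈)) xy ,
                 x∈p∧x∉q⇒x∈p─q y∈W (λ y∈R → y∉ (x∈p∪q⁺ (inj₁ y∈R)))))))

      rest : ∀ R → ∣ R ∣ < m + m → ∀ b → m ≤ ∣ part b (W ─ R) ∣
      rest R ∣R∣< b = +-cancelʳ-≤ (m + m) m _ (begin
        m + (m + m)                            ≤⟨ m≤m+n _ (13 * m) ⟩
        m + (m + m) + 13 * m                   ≡⟨ lem₂ m ⟩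
        16 * m                                 ≤⟨ large b ⟩
        ∣ part b W ∣                           ≤⟨ ∣part∣≤∣part─∣+∣part∣ b W R ⟩
        ∣ part b (W ─ R) ∣ + ∣ part b R ∣      ≤⟨ +-monoʳ-≤ _ (≤-trans (∣p∩q∣≤∣p∣ R _) (<⇒≤ ∣R∣<)) ⟩
        ∣ part b (W ─ R) ∣ + (m + m)           ∎)

      module Extend {R X} (R⊆W : R ⊆ W) (∂≤ : ∣ ∂ R ∣ ≤ 4 * ∣ R ∣) (X⊆ : X ⊆ W ─ R)
                    (¬exp : ¬ (4 * ∣ X ∣ ≤ ∣ (nbr X ∩ (W ─ R)) ─ X ∣)) where

        ∣RX∣ : ∣ R ∪ X ∣ ≡ ∣ R ∣ + ∣ X ∣
        ∣RX∣ = ∣p∪q∣≡∣p∣+∣q∣ R X λ x∈R x∈X → x∈p─q⇒x∉q W R (X⊆ x∈X) x∈R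

        RX⊆W : R ∪ X ⊆ W
        RX⊆W x∈ = [ R⊆W , p─q⊆p W R ∘ X⊆ ]′ (x∈p∪q⁻ R X x∈)

        1≤∣X∣ : 1 ≤ ∣ X ∣
        1≤∣X∣ = n≢0⇒n>0 λ ∣X∣≡0 → ¬exp (subst (λ k → 4 * k ≤ ∣ (nbr X ∩ (W ─ R)) ─ X ∣) (sym ∣X∣≡0) z≤n)

        -- The boundary is subadditive because the neighbours of `X` are counted in `W ─ R`; this is
        -- why expansion of `X` is tested in the remaining set and not in `W`.
        ∂RX⊆ : ∂ (R ∪ X) ⊆ ∂ R ∪ ((nbr X ∩ (W ─ R)) ─ X)
        ∂RX⊆ {y} y∈ =
          let y∈N , y∈W─ = x∈p∩q⁻ (nbr (R ∪ X)) _ y∈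
              y∉ = x∈p─q⇒x∉q W (R ∪ X) y∈W─
              y∈W─R = x∈p∧x∉q⇒x∈p─q (p─q⊆p W _ y∈W─) (λ y∈R → y∉ (x∈p∪q⁺ (inj₁ y∈R)))
              x , x∈ , xy = ∈-nbr⁻ y∈N
          in x∈p∪q⁺ (Sum.map
               (λ x∈R → x∈p∩q⁺ (∈-nbr⁺ x∈R xy , y∈W─R))
               (λ x∈X → x∈p∧x∉q⇒x∈p─q (x∈p∩q⁺ (∈-nbr⁺ x∈X xy , y∈W─R))
                                        (λ y∈X → y∉ (x∈p∪q⁺ (inj₂ y∈X))))
               (x∈p∪q⁻ R X x∈))

        ∂RX≤ : ∣ ∂ (R ∪ X) ∣ ≤ 4 * ∣ R ∪ X ∣
        ∂RX≤ = begin
          ∣ ∂ (R ∪ X) ∣                             ≤⟨ ⊆∪⇒∣∣≤ _ (∂ R) _ ∂RX⊆ ⟩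
          ∣ ∂ R ∣ + ∣ (nbr X ∩ (W ─ R)) ─ X ∣       ≤⟨ +-mono-≤ ∂≤ (<⇒≤ (≰⇒> ¬exp)) ⟩
          4 * ∣ R ∣ + 4 * ∣ X ∣                     ≡⟨ sym (*-distribˡ-+ 4 ∣ R ∣ ∣ X ∣) ⟩
          4 * (∣ R ∣ + ∣ X ∣)                       ≡⟨ cong (4 *_) (sym ∣RX∣) ⟩
          4 * ∣ R ∪ X ∣                             ∎

      -- The empty set expands trivially, so every set moved is nonempty. `R` grows by at least one
      -- vertex in each round, and 2 m rounds are enough.
      prune : ∀ fuel R → R ⊆ W → ∣ R ∣ < m + m → ∣ ∂ R ∣ ≤ 4 * ∣ R ∣ → m + m ≤ fuel + ∣ R ∣ →
              ∃[ R′ ] (∣ R′ ∣ < m + m × Expanding m (W ─ R′))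
      prune zero R _ ∣R∣< _ ≤∣R∣ = contradiction ≤∣R∣ (<⇒≱ ∣R∣<)
      prune (suc fuel) R R⊆W ∣R∣< ∂≤ enough
        with anySubset? (λ X → (X ⊆? W ─ R) ×-dec (∣ X ∣ ≤? m) ×-dec
                               ¬? (4 * ∣ X ∣ ≤? ∣ (nbr X ∩ (W ─ R)) ─ X ∣))
      ... | no ¬X = R , ∣R∣< , λ X X⊆ ∣X∣≤ → decidable-stable (_ ≤? _) (λ ¬exp → ¬X (X , X⊆ , ∣X∣≤ , ¬exp))
      ... | yes (X , X⊆ , ∣X∣≤ , ¬exp) with ∣ R ∪ X ∣ <? m + m
      ...   | no  ≮ = contradiction ∂RX≤ (not-too-large (R ∪ X) RX⊆W (≮⇒≥ ≮)
                        (≤-trans (≤-reflexive ∣RX∣) (+-mono-≤ (<⇒≤ ∣R∣<) ∣X∣≤)))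
        where open Extend R⊆W ∂≤ X⊆ ¬exp
      ...   | yes ∣RX∣< = prune fuel (R ∪ X) RX⊆W ∣RX∣< ∂RX≤ (begin
        m + m                   ≤⟨ enough ⟩
        suc (fuel + ∣ R ∣)      ≡⟨ sym (+-suc fuel ∣ R ∣) ⟩
        fuel + suc ∣ R ∣        ≡⟨ cong (fuel +_) (+-comm 1 ∣ R ∣) ⟩
        fuel + (∣ R ∣ + 1)      ≤⟨ +-monoʳ-≤ fuel (+-monoʳ-≤ ∣ R ∣ 1≤∣X∣) ⟩
        fuel + (∣ R ∣ + ∣ X ∣)  ≡⟨ cong (fuel +_) (sym ∣RX∣) ⟩
        fuel + ∣ R ∪ X ∣        ∎)
        where open Extend R⊆W ∂≤ X⊆ ¬exp

    -- The search cannot finish 2 m vertices: by `finished-small` they would lead to a hole. Hence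
    -- it stops by reaching a stack of `p` vertices.
    find-path : ∀ {W} → W ⊆ U → (∀ b → 5 * m ≤ ∣ part b W ∣) → ∀ p → 1 ≤ p → p ≤ m + m →
                ∃₂ λ x y → ∃[ vs ] (Path x y vs × length vs ≡ p × (∀ {v} → v ∈ᴸ vs → v ∈ W))
    -- The fuel bounds the measure 2 |S| + (length of the stack). Pushing a vertex adds 1 and
    -- finishing one adds 2 - 1, so the measure grows with every step, while it stays below 4 m + p.
    find-path {W} W⊆U large p 1≤p p≤2m = restart (m + m + (m + m) + p) ∅
        (λ x∈ → contradiction x∈ ∉⊥) (λ s∈ → contradiction s∈ ∉⊥)
        (subst (_≤ m + m) (sym (∣⊥∣≡0 n)) z≤n) (m≤m+n _ _)
      where
      open ≤-Reasoning

      lem₁ : ∀ m → m + (m + m + (m + m)) ≡ 5 * m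
      lem₁ = solve-∀
      lem₂ : ∀ s l → suc (s + s + suc l) ≡ suc s + suc s + l
      lem₂ = solve-∀
      lem₃ : ∀ s → suc (s + s + 1) ≡ suc s + suc s
      lem₃ = solve-∀

      outside-large : ∀ S vs b → ∣ S ∣ ≤ m + m → length vs ≤ m + m →
                      m ≤ ∣ part b W ─ (S ∪ fromList vs) ∣
      outside-large S vs b ∣S∣≤ len≤ = +-cancelʳ-≤ (m + m + (m + m)) m _ (begin
        m + (m + m + (m + m))                                ≡⟨ lem₁ m ⟩
        5 * m                                                ≤⟨ large b ⟩
        ∣ part b W ∣                                         ≤⟨ ∣p∣≤∣p─q∣+∣q∣ (part b W) (S ∪ fromList vs) ⟩
        ∣ part b W ─ (S ∪ fromList vs) ∣ + ∣ S ∪ fromList vs ∣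
          ≤⟨ +-monoʳ-≤ ∣ part b W ─ (S ∪ fromList vs) ∣ (≤-trans (∣p∪q∣≤∣p∣+∣q∣ S (fromList vs))
               (+-mono-≤ ∣S∣≤ (≤-trans (∣fromList∣≤length vs) len≤))) ⟩
        ∣ part b W ─ (S ∪ fromList vs) ∣ + (m + m + (m + m)) ∎)

      Finished : Subset n → List (Fin n) → Set
      Finished S vs = ∀ {s w} → s ∈ S → w ∈ W → w ∉ S → w ∉ᴸ vs → ¬ E w s

      ∈-outside : ∀ {b S vs w} → w ∈ part b W ─ (S ∪ fromList vs) → w ∈ W × w ∉ S × w ∉ᴸ vs
      ∈-outside {b} {S} {vs} w∈ =
        let w∉ = x∈p─q⇒x∉q (part b W) (S ∪ fromList vs) w∈
        in proj₁ (∈-part⁻ (p─q⊆p (part b W) (S ∪ fromList vs) w∈)) ,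
           (λ w∈S → w∉ (x∈p∪q⁺ (inj₁ w∈S))) , (λ w∈vs → w∉ (x∈p∪q⁺ (inj₂ (∈-fromList w∈vs))))

      -- With |S| = 2 m, one side of `S` has `m` vertices. At most 4 m vertices are finished or on
      -- the stack, so `m` of the 5 m vertices opposite are untouched. An edge between these two
      -- sets contradicts the invariant `Finished`.
      finished-small : ∀ S vs → S ⊆ W → Finished S vs → length vs ≤ m + m → ∣ S ∣ ≤ m + m → ∣ S ∣ < m + m
      finished-small S vs S⊆W fin len≤ ∣S∣≤ = ≤∧≢⇒< ∣S∣≤ λ ∣S∣≡ →
        let b , m≤ = big-part S (≤-reflexive (sym ∣S∣≡))
            s , w , s∈ , w∈ , sw = edge-between b (part-mono (W⊆U ∘ S⊆W))
              (part-mono W⊆U ∘ p─q⊆p (part (not b) W) (S ∪ fromList vs)) m≤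
              (outside-large S vs (not b) ∣S∣≤ len≤)
            w∈W , w∉S , w∉vs = ∈-outside w∈
        in fin (proj₁ (∈-part⁻ s∈)) w∈W w∉S w∉vs (E-sym sw)

      Result : Set
      Result = ∃₂ λ x y → ∃[ vs ] (Path x y vs × length vs ≡ p × (∀ {v} → v ∈ᴸ vs → v ∈ W))

      -- Depth-first search: S holds the vertices already left, the path is the stack.
      search : ∀ fuel S {x y vs} → Path x y vs → S ⊆ W → (∀ {v} → v ∈ᴸ vs → v ∈ W) →
               (∀ {v} → v ∈ᴸ vs → v ∉ S) → Finished S vs → ∣ S ∣ ≤ m + m → length vs ≤ p →
               m + m + (m + m) + p ≤ fuel + (∣ S ∣ + ∣ S ∣ + length vs) → Result
      restart : ∀ fuel S → S ⊆ W → Finished S [] → ∣ S ∣ ≤ m + m →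
              m + m + (m + m) + p ≤ fuel + (∣ S ∣ + ∣ S ∣) → Result

      restart fuel S S⊆W fin ∣S∣≤ enough =
        let u , u∈ = 1≤∣p∣⇒Nonempty _ (≤-trans 1≤m (outside-large S [] true ∣S∣≤ z≤n))
            u∈W , u∉S , _ = ∈-outside {S = S} {vs = []} u∈
        in search fuel S [ u ] S⊆W (λ { (here refl) → u∈W }) (λ { (here refl) → u∉S })
             (λ s∈ w∈ w∉ _ → fin s∈ w∈ w∉ (λ ())) ∣S∣≤ 1≤p
             (≤-trans enough (+-monoʳ-≤ fuel (m≤m+n _ 1)))

      search fuel S {vs = vs} path S⊆W vs⊆W vs#S fin ∣S∣≤ len≤ enough with length vs ≟ p
      ... | yes len≡ = _ , _ , vs , path , len≡ , vs⊆W
      ... | no  len≢ = step fuel path enough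
        where
        len< : length vs < p
        len< = ≤∧≢⇒< len≤ len≢

        ∣S∣< : ∣ S ∣ < m + m
        ∣S∣< = finished-small S vs S⊆W fin (≤-trans len≤ p≤2m) ∣S∣≤

        retreat⊆ : ∀ {x} → x ∈ W → S ∪ ⁅ x ⁆ ⊆ W
        retreat⊆ {x} x∈W s∈ = [ S⊆W , (λ s∈x → subst (_∈ W) (sym (x∈⁅y⁆⇒x≡y x s∈x)) x∈W) ]′ (x∈p∪q⁻ S ⁅ x ⁆ s∈)

        ∣retreat∣ : ∀ {x} → x ∉ S → ∣ S ∪ ⁅ x ⁆ ∣ ≡ suc ∣ S ∣
        ∣retreat∣ {x} x∉S = trans (∣p∪q∣≡∣p∣+∣q∣ S ⁅ x ⁆ λ s∈S s∈x → x∉S (subst (_∈ S) (x∈⁅y⁆⇒x≡y x s∈x) s∈S))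
                                 (trans (cong (∣ S ∣ +_) (∣⁅x⁆∣≡1 x)) (+-comm ∣ S ∣ 1))

        retreat-finished : ∀ {x us} → (∀ {u} → u ∈ᴸ vs → u ≡ x ⊎ u ∈ᴸ us) →
                           (∀ {w} → w ∈ W → w ∉ S → w ∉ᴸ vs → ¬ E w x) → Finished (S ∪ ⁅ x ⁆) us
        retreat-finished {x} {us} vs⊆ stuck {s} {w} s∈ w∈W w∉ w∉us with x∈p∪q⁻ S ⁅ x ⁆ s∈
        ... | inj₁ s∈S = fin s∈S w∈W (w∉ ∘ x∈p∪q⁺ ∘ inj₁)
                           ([ (λ { refl → w∉ (x∈p∪q⁺ (inj₂ (x∈⁅x⁆ x))) }) , w∉us ]′ ∘ vs⊆)
        ... | inj₂ s∈x = subst (λ s → ¬ E w s) (sym (x∈⁅y⁆⇒x≡y x s∈x))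
                           (stuck w∈W (w∉ ∘ x∈p∪q⁺ ∘ inj₁)
                             ([ (λ { refl → w∉ (x∈p∪q⁺ (inj₂ (x∈⁅x⁆ x))) }) , w∉us ]′ ∘ vs⊆))

        candidate? : ∀ x → Dec (∃[ u ] (u ∈ W × u ∉ S × u ∉ᴸ vs × E u x))
        candidate? x = Fin.any? λ u → (u ∈? W) ×-dec ¬? (u ∈? S) ×-dec
                                      ¬? (Any.any? (u Fin.≟_) vs) ×-dec E? u x

        step : ∀ fuel {x y} → Path x y vs → m + m + (m + m) + p ≤ fuel + (∣ S ∣ + ∣ S ∣ + length vs) → Result
        step zero path enough = contradiction enough (<⇒≱ (+-mono-<-≤ (+-mono-< ∣S∣< ∣S∣<) len≤))
        step (suc fuel) {x} path enough with candidate? x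
        ... | yes (u , u∈W , u∉S , u∉vs , ux) =
          search fuel S (cons ux u∉vs path) S⊆W
            (λ { (here refl) → u∈W ; (there v∈) → vs⊆W v∈ })
            (λ { (here refl) → u∉S ; (there v∈) → vs#S v∈ })
            (λ s∈ w∈ w∉S w∉ → fin s∈ w∈ w∉S (w∉ ∘ there)) ∣S∣≤ len<
            (≤-trans enough (≤-reflexive (trans (sym (+-suc fuel _)) (cong (fuel +_) (sym (+-suc _ (length vs)))))))
        ... | no stuck with path
        ...   | [ _ ] =
          restart fuel (S ∪ ⁅ x ⁆) (retreat⊆ (vs⊆W (here refl)))
            (retreat-finished (λ { (here eq) → inj₁ eq }) (λ w∈ w∉S w∉vs wx → stuck (_ , w∈ , w∉S , w∉vs , wx)))
            (≤-trans (≤-reflexive (∣retreat∣ x∉S)) ∣S∣<)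
            (begin
              m + m + (m + m) + p                  ≤⟨ enough ⟩
              suc fuel + (∣ S ∣ + ∣ S ∣ + 1)        ≡⟨ sym (+-suc fuel _) ⟩
              fuel + suc (∣ S ∣ + ∣ S ∣ + 1)        ≡⟨ cong (fuel +_) (lem₃ ∣ S ∣) ⟩
              fuel + (suc ∣ S ∣ + suc ∣ S ∣)        ≡⟨ cong (λ k → fuel + (k + k)) (sym (∣retreat∣ x∉S)) ⟩
              fuel + (∣ S ∪ ⁅ x ⁆ ∣ + ∣ S ∪ ⁅ x ⁆ ∣) ∎)
          where x∉S = vs#S (here refl)
        ...   | cons {vs = us} _ x∉us tail =
          search fuel (S ∪ ⁅ x ⁆) tail (retreat⊆ (vs⊆W (here refl))) (vs⊆W ∘ there)
            (λ v∈ → [ vs#S (there v∈) , (λ v∈x → x∉us (subst (_∈ᴸ us) (x∈⁅y⁆⇒x≡y x v∈x) v∈)) ]′ ∘ x∈p∪q⁻ S ⁅ x ⁆)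
            (retreat-finished (λ { (here eq) → inj₁ eq ; (there v∈) → inj₂ v∈ })
                              (λ w∈ w∉S w∉vs wx → stuck (_ , w∈ , w∉S , w∉vs , wx)))
            (≤-trans (≤-reflexive (∣retreat∣ x∉S)) ∣S∣<) (≤-trans (n≤1+n _) len≤)
            (begin
              m + m + (m + m) + p                                 ≤⟨ enough ⟩
              suc fuel + (∣ S ∣ + ∣ S ∣ + suc (length us))         ≡⟨ sym (+-suc fuel _) ⟩
              fuel + suc (∣ S ∣ + ∣ S ∣ + suc (length us))         ≡⟨ cong (fuel +_) (lem₂ ∣ S ∣ (length us)) ⟩
              fuel + (suc ∣ S ∣ + suc ∣ S ∣ + length us)
                ≡⟨ cong (λ k → fuel + (k + k + length us)) (sym (∣retreat∣ x∉S)) ⟩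
              fuel + (∣ S ∪ ⁅ x ⁆ ∣ + ∣ S ∪ ⁅ x ⁆ ∣ + length us)   ∎)
          where x∉S = vs#S (here refl)

-- Closing an even cycle

module EvenCycles {n} (side : Fin n → Bool) (E : Fin n → Fin n → Set)
                  (E? : ∀ x y → Dec (E x y)) (E-sym : ∀ {x y} → E x y → E y x)
                  (E-cross : ∀ {x y} → E x y → side x ≡ not (side y)) where

  open Paths E
  open Sides side
  open Crossing side E E? E-sym E-cross

  module Cycles {m U} (1≤m : 1 ≤ m) (hole-free : HoleFree m U) where

    open HoleFreeSet 1≤m hole-free

    -- The path has an even number of vertices, so its ends `x` and `y` lie on opposite sides, and
    -- so do the centres `x′` and `y′`. With equal radii the last layers are then on opposite sides
    -- too, and an edge `w z` joins them. The cycle runs from `x′` out to `w`, from `z` in to `y′`,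
    -- and along the path from `y` to `x`.
    connect : ∀ {d j x y x′ y′ W₂ W₃ vs} → W₂ ⊆ U → W₃ ⊆ U → Disjoint W₂ W₃ →
              (∀ {v} → v ∈ᴸ vs → v ∉ W₂ × v ∉ W₃) → Ball W₂ x′ d → Ball W₃ y′ d → m ≤ 2 ^ d →
              Path y x vs → length vs ≡ j + j → E x′ x → E y′ y →
              CycleOfLength (suc d + (suc d + (j + j)))
    connect {d} {j} {x} {y} {x′} {y′} {W₂} {W₃} {vs} W₂⊆U W₃⊆U W₂#W₃ vs# ball₂ ball₃ m≤2^d path len x′x y′y
      with edge-between (not (alternate d (side x))) {Ball.layer ball₂} {Ball.layer ball₃} layer₂⊆ layer₃⊆
             (≤-trans m≤2^d (≤-reflexive (sym (Ball.∣layer∣ ball₂))))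
             (≤-trans m≤2^d (≤-reflexive (sym (Ball.∣layer∣ ball₃))))
      where
      open ≡-Reasoning

      layer-side : ∀ {W w x} (ball : Ball W x d) → w ∈ Ball.layer ball → side w ≡ alternate d (side x)
      layer-side {x = x} ball w∈ with Ball.to-centre ball w∈
      ... | us , p , len-us , _ = Bool.not-injective
        (trans (path-parity p) (cong (λ k → alternate k (side x)) len-us))

      layer₂⊆ : Ball.layer ball₂ ⊆ part (not (alternate d (side x))) U
      layer₂⊆ {w} w∈ = ∈-part⁺ (W₂⊆U (Ball.ball⊆ ball₂ (Ball.layer⊆ ball₂ w∈))) (begin
        side w                         ≡⟨ layer-side ball₂ w∈ ⟩
        alternate d (side x′)          ≡⟨ cong (alternate d) (E-cross x′x) ⟩
        alternate d (not (side x))     ≡⟨ alternate-not d (side x) ⟩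
        not (alternate d (side x))     ∎)

      side-y′ : side y′ ≡ side x
      side-y′ = begin
        side y′                        ≡⟨ E-cross y′y ⟩
        not (side y)                   ≡⟨ path-parity path ⟩
        alternate (length vs) (side x) ≡⟨ cong (λ k → alternate k (side x)) len ⟩
        alternate (j + j) (side x)     ≡⟨ alternate-even j (side x) ⟩
        side x                         ∎

      layer₃⊆ : Ball.layer ball₃ ⊆ part (not (not (alternate d (side x)))) U
      layer₃⊆ {z} z∈ = ∈-part⁺ (W₃⊆U (Ball.ball⊆ ball₃ (Ball.layer⊆ ball₃ z∈))) (begin
        side z                           ≡⟨ layer-side ball₃ z∈ ⟩
        alternate d (side y′)            ≡⟨ cong (alternate d) side-y′ ⟩
        alternate d (side x)             ≡⟨ sym (Bool.not-involutive _) ⟩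
        not (not (alternate d (side x))) ∎)
    ... | w , z , w∈ , z∈ , wz with Ball.to-centre ball₂ w∈ | Ball.to-centre ball₃ z∈
    ...   | us₂ , p₂ , len₂ , us₂⊆ | us₃ , p₃ , len₃ , us₃⊆ =
      subst CycleOfLength
        (trans (List.length-ʳ++ us₂) (cong₂ _+_ len₂ (trans (List.length-++ us₃) (cong₂ _+_ len₃ len))))
        (close-path E-sym closed (E-sym x′x))
      where
      us₂⊆W₂ : ∀ {u} → u ∈ᴸ us₂ → u ∈ W₂
      us₂⊆W₂ u∈ = Ball.ball⊆ ball₂ (us₂⊆ u∈)
      us₃⊆W₃ : ∀ {u} → u ∈ᴸ us₃ → u ∈ W₃
      us₃⊆W₃ u∈ = Ball.ball⊆ ball₃ (us₃⊆ u∈)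

      closed : Path x′ x (us₂ List.ʳ++ (us₃ List.++ vs))
      closed = glue E-sym p₂
        (append p₃ path y′y λ u∈us₃ u∈vs → proj₂ (vs# u∈vs) (us₃⊆W₃ u∈us₃)) wz
        λ u∈us₂ u∈ → [ (λ u∈us₃ → W₂#W₃ (us₂⊆W₂ u∈us₂) (us₃⊆W₃ u∈us₃))
                     , (λ u∈vs → proj₁ (vs# u∈vs) (us₂⊆W₂ u∈us₂)) ]′ (Mem.∈-++⁻ us₃ u∈)


    -- W₁ hosts the long path; W₂ and W₃ host the balls joining its two ends.
    record Reservoirs : Set where
      field
        W₁ W₂ W₃     : Subset n
        W₁⊆U         : W₁ ⊆ U
        W₂⊆U         : W₂ ⊆ U
        W₃⊆U         : W₃ ⊆ U
        W₁#W₂        : Disjoint W₁ W₂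
        W₁#W₃        : Disjoint W₁ W₃
        W₂#W₃        : Disjoint W₂ W₃
        large-W₁     : ∀ b → 5 * m ≤ ∣ part b W₁ ∣
        W₁⊆nbr       : ∀ {x} → x ∈ W₁ → x ∈ nbr W₂ × x ∈ nbr W₃
        W₂-expanding : Expanding m W₂
        W₃-expanding : Expanding m W₃

    -- The reservoirs before pruning. `V₁` loses at most `m` vertices per side for lack of a
    -- neighbour in `W₂` and as many for `W₃`, so 8 m is ample for the 5 m that the path search
    -- needs.
    record Blocks : Set where
      field
        V₁ V₂ V₃ : Subset n
        V₁⊆U     : V₁ ⊆ U
        V₂⊆U     : V₂ ⊆ U
        V₃⊆U     : V₃ ⊆ U
        V₁#V₂    : Disjoint V₁ V₂
        V₁#V₃    : Disjoint V₁ V₃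
        V₂#V₃    : Disjoint V₂ V₃
        large-V₁ : ∀ b → 8 * m ≤ ∣ part b V₁ ∣
        large-V₂ : ∀ b → 16 * m ≤ ∣ part b V₂ ∣
        large-V₃ : ∀ b → 16 * m ≤ ∣ part b V₃ ∣

    drop-part : ∀ k l {a a′ r} → (k + l) * m ≤ a → a ≤ a′ + r → r ≤ l * m → k * m ≤ a′
    drop-part k l {a} {a′} {r} ≤a a≤ r≤ = +-cancelʳ-≤ (l * m) (k * m) a′
      (≤-trans (≤-reflexive (sym (*-distribʳ-+ m k l))) (≤-trans ≤a (≤-trans a≤ (+-monoʳ-≤ a′ r≤))))

    split-off : ∀ k W → (∀ b → (k + 16) * m ≤ ∣ part b W ∣) →
                ∃[ V ] (V ⊆ W × (∀ b → 16 * m ≤ ∣ part b V ∣) × (∀ b → k * m ≤ ∣ part b (W ─ V) ∣))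
    split-off k W large =
      let V , V⊆W , ∣V∣ = subset-with-parts W (16 * m)
                            (λ b → ≤-trans (*-monoˡ-≤ m (m≤n+m 16 k)) (large b))
      in V , V⊆W , (λ b → ≤-reflexive (sym (∣V∣ b))) ,
         λ b → drop-part k 16 (large b) (∣part∣≤∣part─∣+∣part∣ b W V) (≤-reflexive (∣V∣ b))

    blocks : (∀ b → 40 * m ≤ ∣ part b U ∣) → Blocks
    blocks large = record
      { V₁ = U ─ V₂ ─ V₃ ; V₂ = V₂ ; V₃ = V₃
      ; V₁⊆U = λ x∈ → p─q⊆p U V₂ (V₁⊆ x∈)
      ; V₂⊆U = proj₁ (proj₂ cut₂)
      ; V₃⊆U = λ x∈ → p─q⊆p U V₂ (V₃⊆ x∈)
      ; V₁#V₂ = λ x∈ → x∈p─q⇒x∉q U V₂ (V₁⊆ x∈)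
      ; V₁#V₃ = λ x∈ → x∈p─q⇒x∉q (U ─ V₂) V₃ x∈
      ; V₂#V₃ = λ x∈V₂ x∈V₃ → x∈p─q⇒x∉q U V₂ (V₃⊆ x∈V₃) x∈V₂
      ; large-V₁ = proj₂ (proj₂ (proj₂ cut₃))
      ; large-V₂ = proj₁ (proj₂ (proj₂ cut₂))
      ; large-V₃ = proj₁ (proj₂ (proj₂ cut₃))
      }
      where
      cut₂ = split-off 24 U large
      V₂ = proj₁ cut₂
      cut₃ = split-off 8 (U ─ V₂) (proj₂ (proj₂ (proj₂ cut₂)))
      V₃ = proj₁ cut₃
      V₃⊆ : V₃ ⊆ U ─ V₂
      V₃⊆ = proj₁ (proj₂ cut₃)
      V₁⊆ : U ─ V₂ ─ V₃ ⊆ U ─ V₂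
      V₁⊆ x∈ = p─q⊆p (U ─ V₂) V₃ x∈

    reservoirs : Blocks → Reservoirs
    reservoirs blocks = record
      { W₁ = W₁ ; W₂ = W₂ ; W₃ = W₃
      ; W₁⊆U = λ x∈ → V₁⊆U (W₁⊆V₁ x∈)
      ; W₂⊆U = W₂⊆U
      ; W₃⊆U = W₃⊆U
      ; W₁#W₂ = λ x∈W₁ x∈W₂ → V₁#V₂ (W₁⊆V₁ x∈W₁) (W₂⊆V₂ x∈W₂)
      ; W₁#W₃ = λ x∈W₁ x∈W₃ → V₁#V₃ (W₁⊆V₁ x∈W₁) (W₃⊆V₃ x∈W₃)
      ; W₂#W₃ = λ x∈W₂ x∈W₃ → V₂#V₃ (W₂⊆V₂ x∈W₂) (W₃⊆V₃ x∈W₃)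
      ; large-W₁ = λ b → drop-part 5 2
          (drop-part 7 1 (large-V₁ b) (few-without-neighbours V₁⊆U W₂⊆U large-W₂ b) (m≤m+n m 0))
          (few-without-neighbours (λ x∈ → V₁⊆U (p∩q⊆p V₁ (nbr W₂) x∈)) W₃⊆U large-W₃ b)
          (m≤m+n m (m + 0))
      ; W₁⊆nbr = λ x∈ → p∩q⊆q V₁ (nbr W₂) (p∩q⊆p (V₁ ∩ nbr W₂) (nbr W₃) x∈) ,
                         p∩q⊆q (V₁ ∩ nbr W₂) (nbr W₃) x∈
      ; W₂-expanding = proj₂ (proj₂ (proj₂ pruned₂))
      ; W₃-expanding = proj₂ (proj₂ (proj₂ pruned₃))
      }
      where
      open Blocks blocks
      pruned₂ = hole-free⇒expanding V₂⊆U large-V₂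
      pruned₃ = hole-free⇒expanding V₃⊆U large-V₃
      W₂ = proj₁ pruned₂
      W₃ = proj₁ pruned₃
      W₁ = (V₁ ∩ nbr W₂) ∩ nbr W₃
      W₂⊆V₂ : W₂ ⊆ V₂
      W₂⊆V₂ = proj₁ (proj₂ pruned₂)
      W₃⊆V₃ : W₃ ⊆ V₃
      W₃⊆V₃ = proj₁ (proj₂ pruned₃)
      W₂⊆U : W₂ ⊆ U
      W₂⊆U x∈ = V₂⊆U (W₂⊆V₂ x∈)
      W₃⊆U : W₃ ⊆ U
      W₃⊆U x∈ = V₃⊆U (W₃⊆V₃ x∈)
      W₁⊆V₁ : W₁ ⊆ V₁
      W₁⊆V₁ x∈ = p∩q⊆p V₁ (nbr W₂) (p∩q⊆p (V₁ ∩ nbr W₂) (nbr W₃) x∈)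
      large-W₂ : ∀ b → m ≤ ∣ part b W₂ ∣
      large-W₂ = proj₁ (proj₂ (proj₂ pruned₂))
      large-W₃ : ∀ b → m ≤ ∣ part b W₃ ∣
      large-W₃ = proj₁ (proj₂ (proj₂ pruned₃))

    module FromReservoirs (reservoirs : Reservoirs) where

      open Reservoirs reservoirs

      even-cycle-in-reservoirs : ∀ d j → (∀ {i} → i < d → 2 ^ i ≤ m) → m ≤ 2 ^ d → 1 ≤ j → j ≤ m →
                    CycleOfLength (suc d + (suc d + (j + j)))
      even-cycle-in-reservoirs d j small m≤2^d 1≤j j≤m =
        let y , x , vs , path , len , vs⊆ =
              find-path W₁⊆U large-W₁ (j + j) (≤-trans 1≤j (m≤m+n j j)) (+-mono-≤ j≤m j≤m)
            x′ , x′∈ , x′x = ∈-nbr⁻ (proj₁ (W₁⊆nbr (vs⊆ (last∈ path))))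
            y′ , y′∈ , y′y = ∈-nbr⁻ (proj₂ (W₁⊆nbr (vs⊆ (head∈ path))))
        in connect {j = j} W₂⊆U W₃⊆U W₂#W₃ (λ v∈ → W₁#W₂ (vs⊆ v∈) , W₁#W₃ (vs⊆ v∈))
             (grow W₂-expanding x′∈ d small) (grow W₃-expanding y′∈ d small) m≤2^d path len x′x y′y

    even-cycle : (∀ b → 40 * m ≤ ∣ part b U ∣) → ∀ d j → (∀ {i} → i < d → 2 ^ i ≤ m) → m ≤ 2 ^ d →
                 1 ≤ j → j ≤ m → CycleOfLength (suc d + (suc d + (j + j)))
    even-cycle large = FromReservoirs.even-cycle-in-reservoirs (reservoirs (blocks large))

-- All colours

module Coloured {H : Graph} {t : ℕ} (χ : Colouring H t) where

  open Graph H
  open Colouring χ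

  Coloured : Fin t → Fin order → Fin order → Set
  Coloured c x y = ∃ λ (e : Adj x y) → colour x y e ≡ c

  coloured? : ∀ c x y → Dec (Coloured c x y)
  coloured? c x y with adj? x y
  ... | no ¬e = no (¬e ∘ proj₁)
  ... | yes e = map′ (e ,_) proj₂ (colour x y e Fin.≟ c)

  coloured-sym : ∀ {c x y} → Coloured c x y → Coloured c y x
  coloured-sym {x = x} {y} (e , eq) = adj-sym e , trans (colour-sym y x (adj-sym e) e) eq

  -- A monochromatic copy as a property of the vertex map alone. In this form it can be decided, and
  -- cycles in the graph of one colour provide it directly.
  Copies : ∀ {k} → Fin t → (Fin k → Fin k → Set) → (Fin k → Fin order) → Set
  Copies c R f = (∀ {i j} → f i ≡ f j → i ≡ j) × (∀ {i j} → R i j → Coloured c (f i) (f j))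

  copy : ∀ {c G f} → Copies c (Graph.Adj G) f → MonochromaticCopy G H χ c
  copy {f = f} (f-injective , f-adj) = record
    { embed           = f
    ; embed-injective = f-injective
    ; embed-adj       = proj₁ ∘ f-adj
    ; embed-colour    = proj₂ ∘ f-adj
    }

  copies : ∀ {c G} (C : MonochromaticCopy G H χ c) → Copies c (Graph.Adj G) (MonochromaticCopy.embed C)
  copies C = embed-injective , λ e → embed-adj e , embed-colour e
    where open MonochromaticCopy C

-- k is the length of a cycle obtained from a path on 2 j vertices
-- and two balls of radius d with layers of at least m vertices.
data Fits (m k : ℕ) : Set where
  fits : ∀ d j → (∀ {i} → i < d → 2 ^ i ≤ m) → m ≤ 2 ^ d → 1 ≤ j → j ≤ m →
         suc d + (suc d + (j + j)) ≡ k → Fits m k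

module _ (H : Graph) (side : Fin (Graph.order H) → Bool)
         (adj-cross : ∀ {x y} → Graph.Adj H x y → side x ≡ not (side y)) where

  open Graph H
  open Sides side

  -- It is not known in advance at which stage a colour resists elimination, so the length condition
  -- is required for every scale `m` that can occur.
  bipartite-arrow : ∀ {t m₀} (ns : Fin t → ℕ) → 1 ≤ m₀ → (∀ b → 40 ^ t * m₀ ≤ ∣ part b full ∣) →
    (∀ W → (∀ b → m₀ ≤ ∣ part b W ∣) → ∃₂ λ x y → x ∈ W × y ∈ W × Adj x y) →
    (∀ i m → m₀ ≤ m → 40 * m ≤ 40 ^ t * m₀ → Fits m (ns i)) →
    H ⟶ (λ i → cycle (ns i))
  bipartite-arrow {t} {m₀} ns 1≤m₀ large dense fit χ =
    go t 0 refl full ≤-refl large (λ _ _ _ → z≤n)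
    where
    open Colouring χ
    open Coloured χ

    HasCopy = ∃[ i ] MonochromaticCopy (cycle (ns i)) H χ i

    large? : ∀ m W → Dec (∀ b → m ≤ ∣ part b W ∣)
    large? m W = map′ (λ { (p , q) true → p ; (p , q) false → q }) (λ p → p true , p false)
                      ((m ≤? ∣ part true W ∣) ×-dec (m ≤? ∣ part false W ∣))

    edge? : ∀ c W → Dec (∃₂ λ x y → x ∈ W × y ∈ W × Coloured c x y)
    edge? c W = Fin.any? λ x → Fin.any? λ y → (x ∈? W) ×-dec (y ∈? W) ×-dec coloured? c x y

    -- Colours are eliminated in increasing order: those below `s` are already absent from `U`, and
    -- `r` of them are left. For r = 0, density still gives an edge in `U`, whose colour would have
    -- to be at least `t`.
    go : ∀ r s → s + r ≡ t → ∀ U → 40 ^ r * m₀ ≤ 40 ^ t * m₀ → (∀ b → 40 ^ r * m₀ ≤ ∣ part b U ∣) →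
         (∀ {x y} → x ∈ U → y ∈ U → (e : Adj x y) → s ≤ toℕ (colour x y e)) → HasCopy
    go zero s s+0≡t U _ large later =
      let x , y , x∈U , y∈U , e = dense U (λ b → ≤-trans (m≤m+n m₀ 0) (large b))
      in contradiction (Fin.toℕ<n (colour x y e))
           (≤⇒≯ (≤-trans (≤-reflexive (trans (sym s+0≡t) (+-identityʳ s))) (later x∈U y∈U e)))
    go (suc r) s s+r≡t U ≤top large later =
      decide (anySubset? (λ W → (W ⊆? U) ×-dec large? m W ×-dec ¬? (edge? c W)))
      where
      m = 40 ^ r * m₀
      s<t : s < t
      s<t = ≤-trans (m≤m+n (suc s) r) (≤-reflexive (trans (sym (+-suc s r)) s+r≡t))
      c = fromℕ< s<t

      40m≤top : 40 * m ≤ 40 ^ t * m₀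
      40m≤top = ≤-trans (≤-reflexive (sym (*-assoc 40 (40 ^ r) m₀))) ≤top

      open EvenCycles side (Coloured c) (coloured? c) coloured-sym (adj-cross ∘ proj₁)

      1≤40^r : 1 ≤ 40 ^ r
      1≤40^r = m^n>0 40 r

      m₀≤m : m₀ ≤ m
      m₀≤m = ≤-trans (≤-reflexive (sym (*-identityˡ m₀))) (*-monoˡ-≤ m₀ 1≤40^r)

      40m≤part : ∀ b → 40 * m ≤ ∣ part b U ∣
      40m≤part b = ≤-trans (≤-reflexive (sym (*-assoc 40 (40 ^ r) m₀))) (large b)

      find : (∀ W → W ⊆ U → (∀ b → m ≤ ∣ part b W ∣) → ∃₂ λ x y → x ∈ W × y ∈ W × Coloured c x y) →
             Fits m (ns c) → HasCopy
      find hole-free (fits d j small m≤ 1≤j j≤m length≡) = c , copy (proj₂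
        (subst (Paths.CycleOfLength (Coloured c)) length≡
          (Cycles.even-cycle (≤-trans 1≤m₀ m₀≤m) hole-free 40m≤part d j small m≤ 1≤j j≤m)))

      decide : Dec (∃[ W ] (W ⊆ U × (∀ b → m ≤ ∣ part b W ∣) ×
                            ¬ (∃₂ λ x y → x ∈ W × y ∈ W × Coloured c x y))) → HasCopy
      decide (yes (W , W⊆U , large-W , no-edge)) =
        go r (suc s) (trans (sym (+-suc s r)) s+r≡t) W
           (≤-trans (m≤n*m m 40) 40m≤top) large-W
           λ {x} {y} x∈W y∈W e → ≤∧≢⇒< (later (W⊆U x∈W) (W⊆U y∈W) e) λ s≡ →
             no-edge (x , y , x∈W , y∈W , e ,
                      Fin.toℕ-injective (trans (sym s≡) (sym (Fin.toℕ-fromℕ< s<t))))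
      decide (no no-hole) = find
        (λ W W⊆U large-W → decidable-stable (edge? c W) λ no-edge →
          no-hole (W , W⊆U , large-W , no-edge))
        (fit c m m₀≤m 40m≤top)

-- Existence of the size-Ramsey number

Unique-⊆⇒length≤ : ∀ {A : Set} {xs ys : List A} → Unique xs → (∀ {x} → x ∈ᴸ xs → x ∈ᴸ ys) →
                   length xs ≤ length ys
Unique-⊆⇒length≤ {xs = []} _ _ = z≤n
Unique-⊆⇒length≤ {xs = x ∷ xs} (x∉xs ∷ unique) xs⊆ys with Mem.∈-∃++ (xs⊆ys (here refl))
... | us , vs , refl = begin
  suc (length xs)               ≤⟨ s≤s (Unique-⊆⇒length≤ unique xs⊆us++vs) ⟩
  suc (length (us List.++ vs))  ≡⟨ cong suc (List.length-++ us) ⟩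
  suc (length us + length vs)   ≡⟨ sym (+-suc (length us) (length vs)) ⟩
  length us + suc (length vs)   ≡⟨ sym (List.length-++ us) ⟩
  length (us List.++ x ∷ vs)    ∎
  where
  open ≤-Reasoning
  xs⊆us++vs : ∀ {y} → y ∈ᴸ xs → y ∈ᴸ us List.++ vs
  xs⊆us++vs {y} y∈xs with Mem.∈-++⁻ us (xs⊆ys (there y∈xs))
  ... | inj₁ y∈us          = Mem.∈-++⁺ˡ y∈us
  ... | inj₂ (there y∈vs)  = Mem.∈-++⁺ʳ us y∈vs
  ... | inj₂ (here y≡x)    = contradiction (sym y≡x) (All.lookup x∉xs y∈xs)

module _ (k : ℕ) (es : List (Fin k × Fin k)) where

  private
    Arc : Fin k → Fin k → Set
    Arc u v = toℕ u < toℕ v × (u , v) ∈ᴸ es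

    arc? : ∀ u v → Dec (Arc u v)
    arc? u v = (toℕ u <? toℕ v) ×-dec Any.any? (≡-dec Fin._≟_ Fin._≟_ (u , v)) es

  -- Only ascending pairs count, and repetitions do no harm. Any list of `m` pairs thus gives a
  -- graph with at most `m` edges.
  graphOf : Graph
  graphOf = record
    { order      = k
    ; Adj        = λ u v → Arc u v ⊎ Arc v u
    ; adj?       = λ u v → arc? u v ⊎-dec arc? v u
    ; adj-sym    = Sum.swap
    ; adj-irrefl = λ { refl (inj₁ (u<u , _)) → <-irrefl refl u<u
                     ; refl (inj₂ (u<u , _)) → <-irrefl refl u<u }
    }

  size-graphOf : Graph.size graphOf ≤ length es
  size-graphOf = Unique-⊆⇒length≤ unique-edges edges⊆es
    where
    open Graph graphOf

    listed? : ∀ e → Dec (toℕ (proj₁ e) < toℕ (proj₂ e) × Adj (proj₁ e) (proj₂ e))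
    listed? (u , v) = (u Fin.<? v) ×-dec adj? u v

    unique-edges : Unique edges
    unique-edges = Unique.filter⁺ listed?
      (Unique.cartesianProduct⁺ (Unique.allFin⁺ k) (Unique.allFin⁺ k))

    edges⊆es : ∀ {e} → e ∈ᴸ edges → e ∈ᴸ es
    edges⊆es e∈ with proj₂ (Mem.∈-filter⁻ listed? {xs = cartesianProduct (allFin k) (allFin k)} e∈)
    ... | u<v , inj₁ (_ , e∈es) = e∈es
    ... | u<v , inj₂ (v<u , _)  = contradiction v<u (<-asym u<v)

-- Injectivity of `φ` on non-isolated vertices suffices: every vertex of `G i` has a neighbour, so a
-- copy uses no isolated vertex of `H`.
arrow-transfer : ∀ {t} {G : Fin t → Graph} (H H′ : Graph) (φ : Graph.Vertex H → Graph.Vertex H′) →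
  (∀ {u v} → Graph.Adj H u v → Graph.Adj H′ (φ u) (φ v)) →
  (∀ {u u′ v v′} → Graph.Adj H u u′ → Graph.Adj H v v′ → φ u ≡ φ v → u ≡ v) →
  (∀ i u → ∃[ v ] Graph.Adj (G i) u v) → H ⟶ G → H′ ⟶ G
arrow-transfer H H′ φ φ-adj φ-injective no-isolated H⟶G χ =
  let i , C = H⟶G record
        { colour     = λ u v e → colour (φ u) (φ v) (φ-adj e)
        ; colour-sym = λ u v e e′ → colour-sym (φ u) (φ v) (φ-adj e) (φ-adj e′)
        }
      open MonochromaticCopy C
  in i , record
    { embed           = φ ∘ embed
    ; embed-injective = λ {u} {v} eq → embed-injective
        (φ-injective (embed-adj (proj₂ (no-isolated i u))) (embed-adj (proj₂ (no-isolated i v))) eq)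
    ; embed-adj       = φ-adj ∘ embed-adj
    ; embed-colour    = embed-colour
    }
  where open Colouring χ

cycle-no-isolated : ∀ {k} → 2 ≤ k → ∀ u → ∃[ v ] Graph.Adj (cycle k) u v
cycle-no-isolated {suc k} 2≤k u with suc (toℕ u) <? suc k
... | yes u+1<k = fromℕ< u+1<k ,
  (λ u≡v → 1+n≢n (sym (trans (cong toℕ u≡v) (Fin.toℕ-fromℕ< u+1<k)))) , inj₁ (inj₁ (Fin.toℕ-fromℕ< u+1<k))
... | no  u+1≮k = zero , (λ { refl → u+1≮k 2≤k }) ,
  inj₁ (inj₂ (≤-antisym (Fin.toℕ<n u) (≮⇒≥ u+1≮k) , refl))

-- Deciding the arrow relation by exhaustive search

Searchable : Set → Set₁
Searchable A = ∀ {P : A → Set} → Decidable P → Dec (∃ P)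

search-× : ∀ {A B} → Searchable A → Searchable B → Searchable (A × B)
search-× sA sB P? = map′ (λ (a , b , p) → (a , b) , p) (λ ((a , b) , p) → a , b , p)
                         (sA λ a → sB λ b → P? (a , b))

search-Vec : ∀ {A} → Searchable A → ∀ k → Searchable (Vec A k)
search-Vec sA zero    P? = map′ ([] ,_) (λ { ([] , p) → p }) (P? [])
search-Vec sA (suc k) P? = map′ (λ (a , as , p) → a ∷ as , p) (λ { (a ∷ as , p) → a , as , p })
                                (sA λ a → search-Vec sA k λ as → P? (a ∷ as))

search-all : ∀ {A} → Searchable A → ∀ {P : A → Set} → Decidable P → Dec (∀ a → P a)
search-all sA P? = map′ (λ ¬∃ a → decidable-stable (P? a) λ ¬p → ¬∃ (a , ¬p))
                        (λ all (a , ¬p) → ¬p (all a)) (¬? (sA (¬? ∘ P?)))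

module _ (H : Graph) {t : ℕ} where

  open Graph H

  -- A finite, searchable substitute for colourings, which are functions of adjacency proofs and are
  -- not enumerated directly.
  Matrix : Set
  Matrix = Vec (Vec (Fin t) order) order

  entry : Matrix → Fin order → Fin order → Fin t
  entry M u v = Vec.lookup (Vec.lookup M u) v

  -- Reading only entries on or above the diagonal turns an arbitrary matrix into a colouring.
  symmetrise : (Fin order → Fin order → Fin t) → Fin order → Fin order → Fin t
  symmetrise f u v with u Fin.<? v
  ... | yes _ = f u v
  ... | no  _ = f v u

  symmetrise-sym : ∀ f u v → symmetrise f u v ≡ symmetrise f v u
  symmetrise-sym f u v with u Fin.<? v | v Fin.<? u
  ... | yes u<v | yes v<u = contradiction v<u (<-asym u<v)
  ... | yes _   | no  _   = refl
  ... | no  _   | yes _   = refl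
  ... | no  u≮v | no  v≮u with Fin.toℕ-injective (≤-antisym (≮⇒≥ v≮u) (≮⇒≥ u≮v))
  ...   | refl = refl

  colouringOf : Matrix → Colouring H t
  colouringOf M = record
    { colour     = λ u v _ → symmetrise (entry M) u v
    ; colour-sym = λ u v _ _ → symmetrise-sym (entry M) u v
    }

  copy? : ∀ (χ : Colouring H t) G c → Dec (MonochromaticCopy G H χ c)
  copy? χ G c = map′ (λ (f , C) → copy C)
    (λ C → let open MonochromaticCopy C
               lookup-embed = Vec.lookup∘tabulate embed
           in Vec.tabulate embed ,
              (λ {i} {j} eq → embed-injective (trans (sym (lookup-embed i)) (trans eq (lookup-embed j)))) ,
              λ {i} {j} e → subst₂ (Coloured c) (sym (lookup-embed i)) (sym (lookup-embed j)) (proj₂ (copies C) e))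
    (search-Vec Fin.any? (Graph.order G) (copies? ∘ Vec.lookup))
    where
    open Coloured χ
    copies? : ∀ f → Dec (Copies c (Graph.Adj G) f)
    copies? f =
      map′ (λ p {i} {j} → p i j) (λ p i j → p {i} {j})
        (Fin.all? λ i → Fin.all? λ j → (f i Fin.≟ f j) →-dec (i Fin.≟ j))
      ×-dec
      map′ (λ p {i} {j} → p i j) (λ p i j → p {i} {j})
        (Fin.all? λ i → Fin.all? λ j → Graph.adj? G i j →-dec coloured? c (f i) (f j))

-- Every colouring agrees on the edges with the colouring of some matrix, so testing all matrices
-- tests all colourings.
arrow? : ∀ H {t} (G : Fin (suc t) → Graph) → Dec (H ⟶ G)
arrow? H {t} G = map′ (λ arrow χ → recolour χ (arrow (matrix χ))) (λ arrow M → arrow (colouringOf H M))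
  (search-all (search-Vec (search-Vec Fin.any? order) order)
              λ M → Fin.any? λ i → copy? H (colouringOf H M) (G i) i)
  where
  open Graph H

  module _ (χ : Colouring H (suc t)) where
    open Colouring χ

    value : Fin order → Fin order → Fin (suc t)
    value u v with adj? u v
    ... | yes e = colour u v e
    -- A filler for non-edges; it exists because there is at least one colour.
    ... | no  _ = zero

    value≡colour : ∀ u v (e : Adj u v) → value u v ≡ colour u v e
    value≡colour u v e with adj? u v
    ... | yes _ = refl
    ... | no ¬e = contradiction e ¬e

    matrix : Matrix H
    matrix = Vec.tabulate λ u → Vec.tabulate (value u)

    entry≡value : ∀ u v → entry H matrix u v ≡ value u v
    entry≡value u v = trans (cong (λ row → Vec.lookup row v) (Vec.lookup∘tabulate _ u))
                            (Vec.lookup∘tabulate (value u) v)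

    matrix-colour : ∀ u v (e : Adj u v) → symmetrise H (entry H matrix) u v ≡ colour u v e
    matrix-colour u v e with u Fin.<? v
    ... | yes _ = trans (entry≡value u v) (value≡colour u v e)
    ... | no  _ = trans (entry≡value v u)
                    (trans (value≡colour v u (adj-sym e)) (colour-sym v u (adj-sym e) e))

    recolour : ∃[ i ] MonochromaticCopy (G i) H (colouringOf H matrix) i →
               ∃[ i ] MonochromaticCopy (G i) H χ i
    recolour (i , C) = i , record
      { embed           = embed
      ; embed-injective = embed-injective
      ; embed-adj       = embed-adj
      ; embed-colour    = λ e → trans (sym (matrix-colour _ _ (embed-adj e))) (embed-colour e)
      }
      where open MonochromaticCopy C

least : ∀ {P : ℕ → Set} → Decidable P → ∀ k → P k → ∃[ m ] (m ≤ k × P m × ∀ j → P j → m ≤ j)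
least P? zero    p = 0 , z≤n , p , λ _ _ → z≤n
least P? (suc k) p with P? 0
... | yes p₀ = 0 , z≤n , p₀ , λ _ _ → z≤n
... | no ¬p₀ =
  let m , m≤k , pm , min = least (P? ∘ suc) k p
  in suc m , s≤s m≤k , pm , λ { zero p₀ → contradiction p₀ ¬p₀ ; (suc j) pj → s≤s (min j pj) }

module _ {t} (G : Fin (suc t) → Graph) (no-isolated : ∀ i u → ∃[ v ] Graph.Adj (G i) u v) where

  -- A graph with m edges has at most 2 m non-isolated vertices;
  -- the extra vertex serves as the image of the isolated ones.
  Realisable : ℕ → Set
  Realisable m = ∃ λ (es : Vec (Fin (suc (m + m)) × Fin (suc (m + m))) m) →
                 graphOf (suc (m + m)) (Vec.toList es) ⟶ G

  realisable? : Decidable Realisable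
  realisable? m = search-Vec (search-× Fin.any? Fin.any?) m λ es → arrow? _ G

  module Relabel (H : Graph) where

    open Graph H

    ends : List Vertex
    ends = List.map proj₁ edges List.++ List.map proj₂ edges

    length-ends : length ends ≡ size + size
    length-ends = trans (List.length-++ (List.map proj₁ edges))
      (cong₂ _+_ (List.length-map proj₁ edges) (List.length-map proj₂ edges))

    label : Vertex → Fin (suc (size + size))
    label v with Any.any? (v Fin.≟_) ends
    ... | yes v∈ = suc (subst Fin length-ends (Any.index v∈))
    ... | no  _  = zero

    label-injective : ∀ {u v} → u ∈ᴸ ends → v ∈ᴸ ends → label u ≡ label v → u ≡ v
    label-injective {u} {v} u∈ends v∈ends eq with Any.any? (u Fin.≟_) ends | Any.any? (v Fin.≟_) ends
    ... | no u∉  | _      = contradiction u∈ends u∉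
    ... | yes _  | no v∉  = contradiction v∈ends v∉
    ... | yes u∈ | yes v∈ = begin
      u                                  ≡⟨ Any.lookup-index u∈ ⟩
      List.lookup ends (Any.index u∈)    ≡⟨ cong (List.lookup ends) (subst-injective length-ends (Fin.suc-injective eq)) ⟩
      List.lookup ends (Any.index v∈)    ≡⟨ sym (Any.lookup-index v∈) ⟩
      v                                  ∎
      where open ≡-Reasoning

    listed? : ∀ e → Dec (toℕ (proj₁ e) < toℕ (proj₂ e) × Adj (proj₁ e) (proj₂ e))
    listed? (u , v) = (u Fin.<? v) ×-dec adj? u v

    ∈-edges : ∀ {u v} → toℕ u < toℕ v → Adj u v → (u , v) ∈ᴸ edges
    ∈-edges {u} {v} u<v e = Mem.∈-filter⁺ listed?
      (Mem.∈-cartesianProduct⁺ (Mem.∈-allFin u) (Mem.∈-allFin v)) (u<v , e)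

    ∈-ends : ∀ {u v} → Adj u v → u ∈ᴸ ends
    ∈-ends {u} {v} e with <-cmp (toℕ u) (toℕ v)
    ... | tri< u<v _ _ = Mem.∈-++⁺ˡ (Mem.∈-map⁺ proj₁ (∈-edges u<v e))
    ... | tri≈ _ u≡v _ = contradiction e (adj-irrefl (Fin.toℕ-injective u≡v))
    ... | tri> _ _ v<u = Mem.∈-++⁺ʳ (List.map proj₁ edges) (Mem.∈-map⁺ proj₂ (∈-edges v<u (adj-sym e)))

    sort : ∀ {k} → Fin k × Fin k → Fin k × Fin k
    sort (u , v) with toℕ u <? toℕ v
    ... | yes _ = u , v
    ... | no  _ = v , u

    -- Labels need not preserve the order of the vertices, whereas `graphOf` reads ascending pairs
    -- only; hence the sorting.
    relabel : Vertex × Vertex → Fin (suc (size + size)) × Fin (suc (size + size))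
    relabel (u , v) = sort (label u , label v)

    relabelled : Vec (Fin (suc (size + size)) × Fin (suc (size + size))) size
    relabelled = Vec.map relabel (Vec.fromList edges)

    toList-relabelled : Vec.toList relabelled ≡ List.map relabel edges
    toList-relabelled = trans (Vec.toList-map relabel (Vec.fromList edges))
                              (cong (List.map relabel) (Vec.toList∘fromList edges))

    H′ : Graph
    H′ = graphOf (suc (size + size)) (Vec.toList relabelled)

    adj-label< : ∀ {u v} → toℕ u < toℕ v → Adj u v → Graph.Adj H′ (label u) (label v)
    adj-label< {u} {v} u<v e = sorted (subst (sort (label u , label v) ∈ᴸ_) (sym toList-relabelled)
                                             (Mem.∈-map⁺ relabel (∈-edges u<v e)))
      where
      label≢ : toℕ (label u) ≢ toℕ (label v)
      label≢ eq = <⇒≢ u<v (cong toℕ (label-injective (∈-ends e) (∈-ends (adj-sym e)) (Fin.toℕ-injective eq)))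

      sorted : sort (label u , label v) ∈ᴸ Vec.toList relabelled → Graph.Adj H′ (label u) (label v)
      sorted ∈es with toℕ (label u) <? toℕ (label v)
      ... | yes lu<lv = inj₁ (lu<lv , ∈es)
      ... | no  lu≮lv = inj₂ (≤∧≢⇒< (≮⇒≥ lu≮lv) (≢-sym label≢) , ∈es)

    adj-label : ∀ {u v} → Adj u v → Graph.Adj H′ (label u) (label v)
    adj-label {u} {v} e with <-cmp (toℕ u) (toℕ v)
    ... | tri< u<v _ _ = adj-label< u<v e
    ... | tri≈ _ u≡v _ = contradiction e (adj-irrefl (Fin.toℕ-injective u≡v))
    ... | tri> _ _ v<u = Sum.swap (adj-label< v<u (adj-sym e))

    realise : H ⟶ G → Realisable size
    realise H⟶G = relabelled ,
      arrow-transfer H H′ label adj-label (λ e e′ → label-injective (∈-ends e) (∈-ends e′)) no-isolated H⟶G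

  -- Take the least realisable `m`. The realising graph has at most `m` edges; with fewer, its own
  -- edge list would realise a smaller number.
  size-Ramsey-exists : ∀ H → H ⟶ G → ∃[ m ] (IsSizeRamsey G m × m ≤ Graph.size H)
  size-Ramsey-exists H H⟶G =
    let m , m≤ , (es , H₁⟶G) , minimal = least realisable? (Graph.size H) (Relabel.realise H H⟶G)
        H₁ = graphOf (suc (m + m)) (Vec.toList es)
        size≤m : Graph.size H₁ ≤ m
        size≤m = ≤-trans (size-graphOf _ (Vec.toList es)) (≤-reflexive (Vec.length-toList es))
    in m , ((H₁ , ≤-antisym size≤m (minimal _ (Relabel.realise H₁ H₁⟶G)) , H₁⟶G) ,
            λ H₂ H₂⟶G → minimal _ (Relabel.realise H₂ H₂⟶G)) , m≤

-- A dense bipartite graph with few edges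

sumOver : ∀ {A : Set} → List A → (A → ℕ) → ℕ
sumOver xs f = ListAction.sum (List.map f xs)

module _ {A : Set} where

  sum-cong : ∀ (xs : List A) {f g} → (∀ x → f x ≡ g x) → sumOver xs f ≡ sumOver xs g
  sum-cong xs f≗g = cong ListAction.sum (List.map-cong f≗g xs)

  sum-+ : ∀ (xs : List A) f g → sumOver xs (λ x → f x + g x) ≡ sumOver xs f + sumOver xs g
  sum-+ []       f g = refl
  sum-+ (x ∷ xs) f g rewrite sum-+ xs f g = interchange (f x) (g x) _ _
    where
    interchange : ∀ a b c d → a + b + (c + d) ≡ a + c + (b + d)
    interchange = solve-∀

  sum-*ˡ : ∀ (xs : List A) k f → sumOver xs (λ x → k * f x) ≡ k * sumOver xs f
  sum-*ˡ []       k f = sym (*-zeroʳ k)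
  sum-*ˡ (x ∷ xs) k f rewrite sum-*ˡ xs k f = sym (*-distribˡ-+ k (f x) _)

  sum-*ʳ : ∀ (xs : List A) k f → sumOver xs (λ x → f x * k) ≡ sumOver xs f * k
  sum-*ʳ []       k f = refl
  sum-*ʳ (x ∷ xs) k f rewrite sum-*ʳ xs k f = sym (*-distribʳ-+ k (f x) _)

  sum-0 : ∀ (xs : List A) → sumOver xs (λ _ → 0) ≡ 0
  sum-0 []       = refl
  sum-0 (_ ∷ xs) = sum-0 xs

  length*≤sum : ∀ (xs : List A) {f k} → (∀ {x} → x ∈ᴸ xs → k ≤ f x) → length xs * k ≤ sumOver xs f
  length*≤sum []       k≤ = z≤n
  length*≤sum (x ∷ xs) k≤ = +-mono-≤ (k≤ (here refl)) (length*≤sum xs (k≤ ∘ there))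

  some≥average : ∀ (xs : List A) {f k} → 1 ≤ length xs → length xs * k ≤ sumOver xs f → ∃[ x ] k ≤ f x
  some≥average (x ∷ xs) {f} {k} _ ≤sum with k ≤? f x
  ... | yes k≤ = x , k≤
  some≥average (x ∷ []) _ ≤sum | no k≰ = contradiction (+-cancelʳ-≤ 0 _ _ ≤sum) k≰
  some≥average (x ∷ xs@(_ ∷ _)) {f} {k} _ ≤sum | no k≰ =
    some≥average xs (s≤s z≤n) (+-cancelˡ-≤ k _ _ (≤-trans ≤sum (+-monoˡ-≤ _ (<⇒≤ (≰⇒> k≰)))))

sum-swap : ∀ {A B : Set} (xs : List A) (ys : List B) (w : A → B → ℕ) →
           sumOver xs (λ x → sumOver ys (w x)) ≡ sumOver ys (λ y → sumOver xs (λ x → w x y))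
sum-swap []       ys w = sym (sum-0 ys)
sum-swap (x ∷ xs) ys w =
  trans (cong (sumOver ys (w x) +_) (sum-swap xs ys w)) (sym (sum-+ ys (w x) _))

sum-++ : ∀ {A : Set} (xs ys : List A) f → sumOver (xs List.++ ys) f ≡ sumOver xs f + sumOver ys f
sum-++ xs ys f = trans (cong ListAction.sum (List.map-++ f xs ys)) (ListAction.sum-++ (List.map f xs) (List.map f ys))

sum-map : ∀ {A B : Set} (g : A → B) xs f → sumOver (List.map g xs) f ≡ sumOver xs (f ∘ g)
sum-map g xs f = cong ListAction.sum (sym (List.map-∘ xs))

sum-× : ∀ {A B : Set} (xs : List A) (ys : List B) f →
        sumOver (cartesianProduct xs ys) f ≡ sumOver xs (λ x → sumOver ys (λ y → f (x , y)))
sum-× []       ys f = refl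
sum-× (x ∷ xs) ys f = trans (sum-++ (List.map (x ,_) ys) _ f)
                            (cong₂ _+_ (sum-map (x ,_) ys f) (sum-× xs ys f))

𝟙 : Bool → ℕ
𝟙 true  = 1
𝟙 false = 0

𝟙-∧ : ∀ x y → 𝟙 (x ∧ y) ≡ 𝟙 x * 𝟙 y
𝟙-∧ true  y = sym (+-identityʳ (𝟙 y))
𝟙-∧ false y = refl

sum-𝟙 : (X : Subset n) → sumOver (allFin n) (𝟙 ∘ Vec.lookup X) ≡ ∣ X ∣
sum-𝟙 [] = refl
sum-𝟙 {suc n} (x ∷ X) = trans (cong (𝟙 x +_) tail) (head x)
  where
  tail : sumOver (List.tabulate suc) (𝟙 ∘ Vec.lookup (x ∷ X)) ≡ ∣ X ∣
  tail = trans (cong (λ xs → sumOver xs (𝟙 ∘ Vec.lookup (x ∷ X))) (sym (List.map-tabulate id suc)))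
               (trans (sum-map suc (allFin n) _) (sum-𝟙 X))
  head : ∀ x → 𝟙 x + ∣ X ∣ ≡ ∣ x ∷ X ∣
  head true  = refl
  head false = refl

*-exchange : ∀ a b c → a * (b * c) ≡ b * (a * c)
*-exchange = solve-∀

cancel-power : ∀ D E M {a b} → E * a ≤ D * b → D ^ suc M * b < E ^ suc M → D ^ M * a < E ^ M
cancel-power D E M {a} {b} Ea≤Db <E = *-cancelˡ-< E (D ^ M * a) (E ^ M) (begin-strict
  E * (D ^ M * a)   ≡⟨ *-exchange E (D ^ M) a ⟩
  D ^ M * (E * a)   ≤⟨ *-monoʳ-≤ (D ^ M) Ea≤Db ⟩
  D ^ M * (D * b)   ≡⟨ *-exchange (D ^ M) D b ⟩
  D * (D ^ M * b)   ≡⟨ sym (*-assoc D (D ^ M) b) ⟩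
  D ^ suc M * b     <⟨ <E ⟩
  E ^ suc M         ∎)
  where open ≤-Reasoning

-- Greedy covering

module Greedy {R E : Set} (hit : R → E → Bool) where

  missed : E → List R → List R
  missed e = List.filterᵇ (λ r → not (hit r e))

  missed+hit : ∀ e F → length (missed e F) + sumOver F (λ r → 𝟙 (hit r e)) ≡ length F
  missed+hit e []      = refl
  missed+hit e (r ∷ F) with hit r e
  ... | true  = trans (+-suc _ _) (cong suc (missed+hit e F))
  ... | false = cong suc (missed+hit e F)

  hit-or-missed : ∀ e F {r} → r ∈ᴸ F → hit r e ≡ true ⊎ r ∈ᴸ missed e F
  hit-or-missed e (r ∷ F) (here refl) with hit r e
  ... | true  = inj₁ refl
  ... | false = inj₂ (here refl)
  hit-or-missed e (r ∷ F) (there r∈) with hit r e | hit-or-missed e F r∈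
  ... | _     | inj₁ h  = inj₁ h
  ... | true  | inj₂ m∈ = inj₂ m∈
  ... | false | inj₂ m∈ = inj₂ (there m∈)

  missed⊆ : ∀ e F {r} → r ∈ᴸ missed e F → r ∈ᴸ F
  missed⊆ e (r ∷ F) r∈ with hit r e
  ... | true = there (missed⊆ e F r∈)
  missed⊆ e (r ∷ F) (here eq)  | false = here eq
  missed⊆ e (r ∷ F) (there r∈) | false = there (missed⊆ e F r∈)

  module _ (Es : List E) (D h : ℕ) (1≤∣Es∣ : 1 ≤ length Es) (∣Es∣≤ : length Es ≤ suc D * h) where

    OftenHit : List R → Set
    OftenHit F = ∀ {r} → r ∈ᴸ F → h ≤ sumOver Es (λ e → 𝟙 (hit r e))

    -- Each requirement is hit by at least 1/(D+1) of the candidates. By double counting, some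
    -- candidate hits at least this fraction of `F`.
    best : ∀ F → OftenHit F → ∃[ e ] suc D * length (missed e F) ≤ D * length F
    best F often =
      let e , ∣F∣≤ = some≥average Es 1≤∣Es∣ average
      in e , +-cancelˡ-≤ (length F) _ _ (begin
        length F + suc D * length (missed e F)            ≤⟨ +-monoˡ-≤ _ ∣F∣≤ ⟩
        suc D * hits e + suc D * length (missed e F)      ≡⟨ sym (*-distribˡ-+ (suc D) (hits e) _) ⟩
        suc D * (hits e + length (missed e F))            ≡⟨ cong (suc D *_) (+-comm (hits e) _) ⟩
        suc D * (length (missed e F) + hits e)            ≡⟨ cong (suc D *_) (missed+hit e F) ⟩
        length F + D * length F                           ∎)
      where
      open ≤-Reasoning
      hits : E → ℕ
      hits e = sumOver F (λ r → 𝟙 (hit r e))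

      reorder : ∀ a b c → a * b * c ≡ a * (c * b)
      reorder = solve-∀

      average : length Es * length F ≤ sumOver Es (λ e → suc D * hits e)
      average = begin
        length Es * length F                                     ≤⟨ *-monoˡ-≤ (length F) ∣Es∣≤ ⟩
        suc D * h * length F                                     ≡⟨ reorder (suc D) h (length F) ⟩
        suc D * (length F * h)                                   ≤⟨ *-monoʳ-≤ (suc D) (length*≤sum F often) ⟩
        suc D * sumOver F (λ r → sumOver Es (λ e → 𝟙 (hit r e))) ≡⟨ cong (suc D *_) (sum-swap F Es (λ r e → 𝟙 (hit r e))) ⟩
        suc D * sumOver Es hits                                  ≡⟨ sym (sum-*ˡ Es (suc D) hits) ⟩
        sumOver Es (λ e → suc D * hits e)                        ∎

    Cover : ℕ → List R → Set
    Cover M F = ∃[ es ] (length es ≤ M × (∀ {r} → r ∈ᴸ F → ∃[ e ] (e ∈ᴸ es × hit r e ≡ true)))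

    extend : ∀ {M} e F → Cover M (missed e F) → Cover (suc M) F
    extend e F (es , len , hits) = e ∷ es , s≤s len , λ r∈ →
      [ (λ h → e , here refl , h)
      , (λ m∈ → let e′ , e′∈ , h = hits m∈ in e′ , there e′∈ , h)
      ]′ (hit-or-missed e F r∈)

    -- After `M` greedy choices at most (D/(D+1))^M |F| requirements are missed. This is less than
    -- 1, so none is left.
    cover : ∀ M F → OftenHit F → D ^ M * length F < suc D ^ M → Cover M F
    cover zero [] _ _ = [] , z≤n , λ ()
    cover zero (_ ∷ _) _ (s≤s ())
    cover (suc M) F often <D = step (best F often)
      where
      step : ∃[ e ] suc D * length (missed e F) ≤ D * length F → Cover (suc M) F
      step (e , missed≤) = extend e F
        (cover M (missed e F) (often ∘ missed⊆ e F) (cancel-power D (suc D) M missed≤ <D))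

-- Counting subsets of a given size

subsets : ∀ n → ℕ → List (Subset n)
subsets zero    zero    = [] ∷ []
subsets zero    (suc m) = []
subsets (suc n) zero    = List.map (false ∷_) (subsets n zero)
subsets (suc n) (suc m) = List.map (true ∷_) (subsets n m) List.++ List.map (false ∷_) (subsets n (suc m))

∈-subsets⁺ : (X : Subset n) → X ∈ᴸ subsets n ∣ X ∣
∈-subsets⁺ [] = here refl
∈-subsets⁺ (true ∷ X) = Mem.∈-++⁺ˡ (Mem.∈-map⁺ (true ∷_) (∈-subsets⁺ X))
∈-subsets⁺ {suc n} (false ∷ X) with ∣ X ∣ | ∈-subsets⁺ X
... | zero  | X∈ = Mem.∈-map⁺ (false ∷_) X∈
... | suc m | X∈ = Mem.∈-++⁺ʳ (List.map (true ∷_) (subsets n m)) (Mem.∈-map⁺ (false ∷_) X∈)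

∈-subsets⁻ : ∀ n m {X} → X ∈ᴸ subsets n m → ∣ X ∣ ≡ m
∈-subsets⁻ zero    zero    (here refl) = refl
∈-subsets⁻ (suc n) zero X∈ with Mem.∈-map⁻ (false ∷_) X∈
... | _ , Y∈ , refl = ∈-subsets⁻ n zero Y∈
∈-subsets⁻ (suc n) (suc m) X∈ with Mem.∈-++⁻ (List.map (true ∷_) (subsets n m)) X∈
... | inj₁ X∈₁ with Mem.∈-map⁻ (true ∷_) X∈₁
...   | _ , Y∈ , refl = cong suc (∈-subsets⁻ n m Y∈)
∈-subsets⁻ (suc n) (suc m) X∈ | inj₂ X∈₂ with Mem.∈-map⁻ (false ∷_) X∈₂
...   | _ , Y∈ , refl = ∈-subsets⁻ n (suc m) Y∈

-- A term of the binomial expansion of (1 + 1/K)ⁿ, with denominators cleared.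
length-subsets : ∀ K n m → length (subsets n m) * K ^ n ≤ K ^ m * suc K ^ n
length-subsets K zero    zero    = ≤-refl
length-subsets K zero    (suc m) = z≤n
length-subsets K (suc n) zero    = begin
  length (List.map (false ∷_) (subsets n 0)) * (K * K ^ n) ≡⟨ cong (_* (K * K ^ n)) (List.length-map (false ∷_) (subsets n 0)) ⟩
  length (subsets n 0) * (K * K ^ n)                       ≡⟨ *-exchange (length (subsets n 0)) K (K ^ n) ⟩
  K * (length (subsets n 0) * K ^ n)                       ≤⟨ *-mono-≤ (n≤1+n K) (length-subsets K n 0) ⟩
  suc K * (1 * suc K ^ n)                                  ≡⟨ *-exchange (suc K) 1 (suc K ^ n) ⟩
  1 * (suc K * suc K ^ n)                                  ∎
  where open ≤-Reasoning
length-subsets K (suc n) (suc m) = begin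
  length (List.map (true ∷_) (subsets n m) List.++ List.map (false ∷_) (subsets n (suc m))) * (K * K ^ n)
    ≡⟨ cong (_* (K * K ^ n)) (trans (List.length-++ (List.map (true ∷_) (subsets n m)))
         (cong₂ _+_ (List.length-map (true ∷_) (subsets n m)) (List.length-map (false ∷_) (subsets n (suc m))))) ⟩
  (a + b) * (K * K ^ n)                       ≡⟨ expand a b K (K ^ n) ⟩
  K * (a * K ^ n) + K * (b * K ^ n)           ≤⟨ +-mono-≤ (*-monoʳ-≤ K (length-subsets K n m)) (*-monoʳ-≤ K (length-subsets K n (suc m))) ⟩
  K * (K ^ m * suc K ^ n) + K * (K * K ^ m * suc K ^ n) ≡⟨ collect K (K ^ m) (suc K ^ n) ⟩
  K * K ^ m * (suc K * suc K ^ n)             ∎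
  where
  open ≤-Reasoning
  a = length (subsets n m)
  b = length (subsets n (suc m))
  expand : ∀ a b k p → (a + b) * (k * p) ≡ k * (a * p) + k * (b * p)
  expand = solve-∀
  collect : ∀ k p q → k * (p * q) + k * (k * p * q) ≡ k * p * ((1 + k) * q)
  collect = solve-∀

-- This is (1 + 1/x)^j ≤ 1 + 2j/x with denominators cleared; 2j ≤ x absorbs the quadratic term of
-- the induction step.
bernoulli-upper : ∀ x j → 2 * j ≤ x → x * suc x ^ j ≤ (x + 2 * j) * x ^ j
bernoulli-upper x zero    _ = ≤-reflexive (cong (_* 1) (sym (+-identityʳ x)))
bernoulli-upper x (suc j) 2j+2≤x = begin
  x * (suc x * suc x ^ j)                ≡⟨ *-exchange x (suc x) (suc x ^ j) ⟩
  suc x * (x * suc x ^ j)                ≤⟨ *-monoʳ-≤ (suc x) (bernoulli-upper x j 2j≤x) ⟩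
  suc x * ((x + 2 * j) * x ^ j)                  ≡⟨ expand x j (x ^ j) ⟩
  (x * x + x + 2 * j * x + 2 * j) * x ^ j        ≤⟨ *-monoˡ-≤ (x ^ j) (+-monoʳ-≤ (x * x + x + 2 * j * x) 2j≤x) ⟩
  (x * x + x + 2 * j * x + x) * x ^ j            ≡⟨ collect x j (x ^ j) ⟩
  (x + 2 * suc j) * (x * x ^ j)                  ∎
  where
  open ≤-Reasoning
  2j≤x : 2 * j ≤ x
  2j≤x = ≤-trans (*-monoʳ-≤ 2 (n≤1+n j)) 2j+2≤x
  expand : ∀ x j p → (1 + x) * ((x + 2 * j) * p) ≡ (x * x + x + 2 * j * x + 2 * j) * p
  expand = solve-∀
  collect : ∀ x j p → (x * x + x + 2 * j * x + x) * p ≡ (x + 2 * (1 + j)) * (x * p)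
  collect = solve-∀

-- The first two terms of the binomial expansion.
bernoulli-lower : ∀ y j → y ^ suc j + suc j * y ^ j ≤ suc y ^ suc j
bernoulli-lower y zero    = ≤-reflexive (base y)
  where
  base : ∀ y → y * 1 + 1 ≡ (1 + y) * 1
  base = solve-∀
bernoulli-lower y (suc j) = begin
  y * (y * y ^ j) + suc (suc j) * (y * y ^ j)           ≤⟨ m≤m+n _ (suc j * y ^ j) ⟩
  y * (y * y ^ j) + suc (suc j) * (y * y ^ j) + suc j * y ^ j ≡⟨ factor y j (y ^ j) ⟩
  suc y * (y * y ^ j + suc j * y ^ j)                   ≤⟨ *-monoʳ-≤ (suc y) (bernoulli-lower y j) ⟩
  suc y * suc y ^ suc j                                 ∎
  where
  open ≤-Reasoning
  factor : ∀ y j p → y * (y * p) + (2 + j) * (y * p) + (1 + j) * p ≡ (1 + y) * (y * p + (1 + j) * p)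
  factor = solve-∀

2*y^[1+y]≤[1+y]^[1+y] : ∀ y → 2 * y ^ suc y ≤ suc y ^ suc y
2*y^[1+y]≤[1+y]^[1+y] y = begin
  2 * y ^ suc y                  ≡⟨ cong (y ^ suc y +_) (+-identityʳ (y ^ suc y)) ⟩
  y ^ suc y + y * y ^ y          ≤⟨ +-monoʳ-≤ (y ^ suc y) (*-monoˡ-≤ (y ^ y) (n≤1+n y)) ⟩
  y ^ suc y + suc y * y ^ y      ≤⟨ bernoulli-lower y y ⟩
  suc y ^ suc y                  ∎
  where open ≤-Reasoning

*-^-distrib : ∀ a b n → (a * b) ^ n ≡ a ^ n * b ^ n
*-^-distrib a b zero    = refl
*-^-distrib a b (suc n) = trans (cong (a * b *_) (*-^-distrib a b n)) (reorder a b (a ^ n) (b ^ n))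
  where
  reorder : ∀ a b c d → a * b * (c * d) ≡ a * c * (b * d)
  reorder = solve-∀

-- An elementary substitute for (1 + 1/K)^K < e: the exponent K/2 gives at most 2, and squaring
-- gives 4. This is why `K` is written as 2 * j.
[1+K]^K≤4*K^K : ∀ j .{{_ : NonZero j}} → suc (2 * j) ^ (2 * j) ≤ 4 * (2 * j) ^ (2 * j)
[1+K]^K≤4*K^K j = begin
  suc K ^ (2 * j)                ≡⟨ square (suc K) ⟩
  suc K ^ j * suc K ^ j          ≤⟨ *-mono-≤ half half ⟩
  2 * K ^ j * (2 * K ^ j)        ≡⟨ collect (K ^ j) ⟩
  4 * (K ^ j * K ^ j)            ≡⟨ cong (4 *_) (sym (square K)) ⟩
  4 * K ^ (2 * j)                ∎
  where
  open ≤-Reasoning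
  K = 2 * j
  square : ∀ x → x ^ (2 * j) ≡ x ^ j * x ^ j
  square x = trans (cong (λ i → x ^ (j + i)) (+-identityʳ j)) (^-distribˡ-+-* x j j)
  collect : ∀ a → 2 * a * (2 * a) ≡ 4 * (a * a)
  collect = solve-∀
  double : ∀ k a → (k + k) * a ≡ k * (2 * a)
  double = solve-∀
  half : suc K ^ j ≤ 2 * K ^ j
  half = *-cancelˡ-≤ K {{m*n≢0 2 j}} (≤-trans (bernoulli-upper K j ≤-refl) (≤-reflexive (double K (K ^ j))))

-- The usual bound (eK)^m for the binomial coefficient of Km over m, with 4 in place of e.
length-subsets≤ : ∀ j m .{{_ : NonZero j}} → length (subsets (2 * j * m) m) ≤ (4 * (2 * j)) ^ m
length-subsets≤ j m = *-cancelʳ-≤ _ _ (K ^ (K * m)) {{m^n≢0 K (K * m) {{m*n≢0 2 j}}}} (begin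
  length (subsets (K * m) m) * K ^ (K * m)   ≤⟨ length-subsets K (K * m) m ⟩
  K ^ m * suc K ^ (K * m)                    ≡⟨ cong (K ^ m *_) (sym (^-*-assoc (suc K) K m)) ⟩
  K ^ m * (suc K ^ K) ^ m                    ≤⟨ *-monoʳ-≤ (K ^ m) (^-monoˡ-≤ m ([1+K]^K≤4*K^K j)) ⟩
  K ^ m * (4 * K ^ K) ^ m                    ≡⟨ cong (K ^ m *_) (*-^-distrib 4 (K ^ K) m) ⟩
  K ^ m * (4 ^ m * (K ^ K) ^ m)              ≡⟨ cong (λ x → K ^ m * (4 ^ m * x)) (^-*-assoc K K m) ⟩
  K ^ m * (4 ^ m * K ^ (K * m))              ≡⟨ reorder (K ^ m) (4 ^ m) (K ^ (K * m)) ⟩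
  4 ^ m * K ^ m * K ^ (K * m)                ≡⟨ cong (_* K ^ (K * m)) (sym (*-^-distrib 4 K m)) ⟩
  (4 * K) ^ m * K ^ (K * m)                  ∎)
  where
  open ≤-Reasoning
  K = 2 * j
  reorder : ∀ a b c → a * (b * c) ≡ b * a * c
  reorder = solve-∀

length-cartesianProduct : ∀ {A B : Set} (xs : List A) (ys : List B) →
                          length (cartesianProduct xs ys) ≡ length xs * length ys
length-cartesianProduct []       ys = refl
length-cartesianProduct (x ∷ xs) ys = trans (List.length-++ (List.map (x ,_) ys))
  (cong₂ _+_ (List.length-map (x ,_) ys) (length-cartesianProduct xs ys))

-- Every D + 1 greedy choices at least halve what is missed, since (1 + 1/D)^(D+1) ≥ 2.
decay : ∀ D e c .{{_ : NonZero D}} → c < 2 ^ e → D ^ (suc D * e) * c < suc D ^ (suc D * e)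
decay D e c c<2^e = begin-strict
  D ^ (suc D * e) * c                <⟨ *-monoʳ-< (D ^ (suc D * e)) {{m^n≢0 D (suc D * e)}} c<2^e ⟩
  D ^ (suc D * e) * 2 ^ e            ≡⟨ cong (_* 2 ^ e) (sym (^-*-assoc D (suc D) e)) ⟩
  (D ^ suc D) ^ e * 2 ^ e            ≡⟨ sym (*-^-distrib (D ^ suc D) 2 e) ⟩
  (D ^ suc D * 2) ^ e                ≡⟨ cong (_^ e) (*-comm (D ^ suc D) 2) ⟩
  (2 * D ^ suc D) ^ e                ≤⟨ ^-monoˡ-≤ e (2*y^[1+y]≤[1+y]^[1+y] D) ⟩
  (suc D ^ suc D) ^ e                ≡⟨ ^-*-assoc (suc D) (suc D) e ⟩
  suc D ^ (suc D * e)                ∎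
  where open ≤-Reasoning

rectangle : (Subset n × Subset n) → (Fin n × Fin n) → Bool
rectangle (X , Y) (a , b) = Vec.lookup X a ∧ Vec.lookup Y b

sum-rectangle : (X Y : Subset n) →
  sumOver (cartesianProduct (allFin n) (allFin n)) (λ e → 𝟙 (rectangle (X , Y) e)) ≡ ∣ X ∣ * ∣ Y ∣
sum-rectangle {n} X Y = begin
  sumOver (cartesianProduct (allFin n) (allFin n)) (λ e → 𝟙 (rectangle (X , Y) e))
    ≡⟨ sum-× (allFin n) (allFin n) _ ⟩
  sumOver (allFin n) (λ a → sumOver (allFin n) (λ b → 𝟙 (Vec.lookup X a ∧ Vec.lookup Y b)))
    ≡⟨ sum-cong (allFin n) (λ a → trans (sum-cong (allFin n) λ b → 𝟙-∧ (Vec.lookup X a) (Vec.lookup Y b))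
                                        (trans (sum-*ˡ (allFin n) (𝟙 (Vec.lookup X a)) _)
                                               (cong (𝟙 (Vec.lookup X a) *_) (sum-𝟙 Y)))) ⟩
  sumOver (allFin n) (λ a → 𝟙 (Vec.lookup X a) * ∣ Y ∣)
    ≡⟨ sum-*ʳ (allFin n) ∣ Y ∣ _ ⟩
  sumOver (allFin n) (𝟙 ∘ Vec.lookup X) * ∣ Y ∣
    ≡⟨ cong (_* ∣ Y ∣) (sum-𝟙 X) ⟩
  ∣ X ∣ * ∣ Y ∣ ∎
  where open ≡-Reasoning


-- Requirements are pairs of `m`-subsets and candidates are pairs of vertices. A pair of subsets is
-- hit by m² of the N² candidates, a fraction of at least 1/(D+1).
subsets-dense : ∀ {N} m D e → .{{_ : NonZero D}} → 1 ≤ N → N * N ≤ suc D * (m * m) →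
  length (subsets N m) * length (subsets N m) < 2 ^ e →
  ∃ λ (es : List (Fin N × Fin N)) → length es ≤ suc D * e ×
    (∀ X Y → m ≤ ∣ X ∣ → m ≤ ∣ Y ∣ → ∃₂ λ a b → (a , b) ∈ᴸ es × a ∈ X × b ∈ Y)
subsets-dense {N} m D e 1≤N N*N≤ <2^e =
  conclude (cover Es D (m * m) 1≤∣Es∣ ∣Es∣≤ (suc D * e) F often (decay D e (length F) ∣F∣<2^e))
  where
  open Greedy (rectangle {N})

  F = cartesianProduct (subsets N m) (subsets N m)
  Es = cartesianProduct (allFin N) (allFin N)

  ∣Es∣≡ : length Es ≡ N * N
  ∣Es∣≡ = trans (length-cartesianProduct (allFin N) (allFin N))
    (cong₂ _*_ (List.length-tabulate {n = N} id) (List.length-tabulate {n = N} id))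

  1≤∣Es∣ : 1 ≤ length Es
  1≤∣Es∣ = ≤-trans (*-mono-≤ 1≤N 1≤N) (≤-reflexive (sym ∣Es∣≡))

  ∣Es∣≤ : length Es ≤ suc D * (m * m)
  ∣Es∣≤ = ≤-trans (≤-reflexive ∣Es∣≡) N*N≤

  ∣F∣<2^e : length F < 2 ^ e
  ∣F∣<2^e = subst (_< 2 ^ e) (sym (length-cartesianProduct (subsets N m) (subsets N m))) <2^e

  often : OftenHit Es D (m * m) 1≤∣Es∣ ∣Es∣≤ F
  often {X , Y} XY∈ =
    let X∈ , Y∈ = Mem.∈-cartesianProduct⁻ (subsets N m) (subsets N m) XY∈
    in ≤-reflexive (sym (trans (sum-rectangle X Y) (cong₂ _*_ (∈-subsets⁻ N m X∈) (∈-subsets⁻ N m Y∈))))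

  ∈-subsets : ∀ (X : Subset N) → ∣ X ∣ ≡ m → X ∈ᴸ subsets N m
  ∈-subsets X refl = ∈-subsets⁺ X

  conclude : Cover Es D (m * m) 1≤∣Es∣ ∣Es∣≤ (suc D * e) F → _
  conclude (es , len , covered) = es , len , λ X Y m≤∣X∣ m≤∣Y∣ →
    let X′ , X′⊆X , ∣X′∣ = subset-of-size X m m≤∣X∣
        Y′ , Y′⊆Y , ∣Y′∣ = subset-of-size Y m m≤∣Y∣
        (a , b) , ab∈ , hit = covered (Mem.∈-cartesianProduct⁺ (∈-subsets X′ ∣X′∣) (∈-subsets Y′ ∣Y′∣))
    in a , b , ab∈ , X′⊆X (Vec.lookup⇒[]= a X′ (Bool.∧-conicalˡ _ _ hit))
                   , Y′⊆Y (Vec.lookup⇒[]= b Y′ (Bool.∧-conicalʳ (Vec.lookup X′ a) _ hit))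

dense-bipartite : ∀ j m e → .{{_ : NonZero j}} → .{{_ : NonZero m}} →
  (4 * (2 * j)) ^ m * (4 * (2 * j)) ^ m < 2 ^ e →
  ∃ λ (es : List (Fin (2 * j * m) × Fin (2 * j * m))) → length es ≤ 2 * j * (2 * j) * e ×
    (∀ X Y → m ≤ ∣ X ∣ → m ≤ ∣ Y ∣ → ∃₂ λ a b → (a , b) ∈ᴸ es × a ∈ X × b ∈ Y)
dense-bipartite j@(suc i) m e <2^e =
  subst (λ D → ∃ λ (es : List (Fin N × Fin N)) → length es ≤ D * e ×
                 (∀ X Y → m ≤ ∣ X ∣ → m ≤ ∣ Y ∣ → ∃₂ λ a b → (a , b) ∈ᴸ es × a ∈ X × b ∈ Y))
        1+D≡K*K
        (subsets-dense m D e 1≤N (≤-reflexive (trans (reorder K m) (cong (_* (m * m)) (sym 1+D≡K*K))))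
          (≤-<-trans (*-mono-≤ (length-subsets≤ j m) (length-subsets≤ j m)) <2^e))
  where
  K = 2 * j
  N = K * m
  -- K² - 1 without subtraction; the outer `suc` makes it visibly nonzero.
  D = suc (2 * i + (1 + 2 * i) * (2 + 2 * i))

  1+D≡K*K : suc D ≡ K * K
  1+D≡K*K = expand i
    where
    expand : ∀ i → 1 + (1 + (2 * i + (1 + 2 * i) * (2 + 2 * i))) ≡ 2 * (1 + i) * (2 * (1 + i))
    expand = solve-∀

  reorder : ∀ a b → a * b * (a * b) ≡ a * a * (b * b)
  reorder = solve-∀

  1≤N : 1 ≤ N
  1≤N = >-nonZero⁻¹ N {{m*n≢0 K m {{m*n≢0 2 j}}}}

∣∣≤-injection : ∀ {a b} (p : Subset a) (q : Subset b) (g : Fin a → Fin b) → (∀ {x} → x ∈ p → g x ∈ q) →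
                (∀ {x y} → x ∈ p → y ∈ p → g x ≡ g y → x ≡ y) → ∣ p ∣ ≤ ∣ q ∣
∣∣≤-injection []          q g _  _   = z≤n
∣∣≤-injection (false ∷ p) q g g∈ inj = ∣∣≤-injection p q (g ∘ suc) (g∈ ∘ there)
  λ x∈ y∈ eq → Fin.suc-injective (inj (there x∈) (there y∈) eq)
∣∣≤-injection (true ∷ p)  q g g∈ inj = ≤-trans
  (s≤s (∣∣≤-injection p (q - g zero) (g ∘ suc)
    (λ x∈ → x∈p∧x≢y⇒x∈p-y (g∈ (there x∈)) λ eq → case inj (there x∈) here eq of λ ())
    (λ x∈ y∈ eq → Fin.suc-injective (inj (there x∈) (there y∈) eq))))
  (x∈p⇒∣p-x∣<∣p∣ (g∈ here))

-- The bipartite graph on two copies of the vertex set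

module Bipartite (N : ℕ) (es : List (Fin N × Fin N)) where

  arm : Bool → Fin N → Fin (N + N)
  arm true  a = a ↑ˡ N
  arm false a = N ↑ʳ a

  side : Fin (N + N) → Bool
  side x = [ (λ _ → true) , (λ _ → false) ]′ (splitAt N x)

  fold : Fin (N + N) → Fin N
  fold x = [ id , id ]′ (splitAt N x)

  side-arm : ∀ b a → side (arm b a) ≡ b
  side-arm true  a = cong [ (λ _ → true) , (λ _ → false) ]′ (Fin.splitAt-↑ˡ N a N)
  side-arm false a = cong [ (λ _ → true) , (λ _ → false) ]′ (Fin.splitAt-↑ʳ N N a)

  fold-arm : ∀ b a → fold (arm b a) ≡ a
  fold-arm true  a = cong [ id , id ]′ (Fin.splitAt-↑ˡ N a N)
  fold-arm false a = cong [ id , id ]′ (Fin.splitAt-↑ʳ N N a)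

  arm-fold : ∀ {b x} → side x ≡ b → arm b (fold x) ≡ x
  arm-fold {x = x} refl with splitAt N x | Fin.join-splitAt N N x
  ... | inj₁ a | eq = eq
  ... | inj₂ a | eq = eq

  open Sides side

  H : Graph
  H = graphOf (N + N) (List.map (λ (a , b) → arm true a , arm false b) es)

  size-H : Graph.size H ≤ length es
  size-H = ≤-trans (size-graphOf (N + N) _) (≤-reflexive (List.length-map _ es))

  adj-cross : ∀ {x y} → Graph.Adj H x y → side x ≡ not (side y)
  adj-cross (inj₁ (_ , e∈)) with Mem.∈-map⁻ _ e∈
  ... | (a , b) , _ , refl = trans (side-arm true a) (cong not (sym (side-arm false b)))
  adj-cross (inj₂ (_ , e∈)) with Mem.∈-map⁻ _ e∈
  ... | (a , b) , _ , refl = trans (side-arm false b) (cong not (sym (side-arm true a)))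

  ∣full-part∣ : ∀ b → N ≤ ∣ part b full ∣
  ∣full-part∣ b = ≤-trans (≤-reflexive (sym (∣⊤∣≡n N)))
    (∣∣≤-injection full (part b full) (arm b) (λ {a} _ → ∈-part⁺ ∈⊤ (side-arm b a))
      λ {a} {a′} _ _ eq → trans (sym (fold-arm b a)) (trans (cong fold eq) (fold-arm b a′)))

  in-trace? : ∀ b W → Decidable (λ a → arm b a ∈ W)
  in-trace? b W a = arm b a ∈? W

  ∣part∣≤∣trace∣ : ∀ b W → ∣ part b W ∣ ≤ ∣ select (in-trace? b W) ∣
  ∣part∣≤∣trace∣ b W = ∣∣≤-injection (part b W) (select (in-trace? b W)) fold
    (λ x∈ → let x∈W , sx = ∈-part⁻ x∈ in ∈-select⁺ (in-trace? b W) (subst (_∈ W) (sym (arm-fold sx)) x∈W))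
    (λ x∈ y∈ eq → trans (sym (arm-fold (proj₂ (∈-part⁻ x∈))))
                        (trans (cong (arm b) eq) (arm-fold (proj₂ (∈-part⁻ y∈)))))

  dense : ∀ {m} → (∀ X Y → m ≤ ∣ X ∣ → m ≤ ∣ Y ∣ → ∃₂ λ a b → (a , b) ∈ᴸ es × a ∈ X × b ∈ Y) →
          ∀ W → (∀ b → m ≤ ∣ part b W ∣) → ∃₂ λ x y → x ∈ W × y ∈ W × Graph.Adj H x y
  dense dense-es W large =
    let a , b , ab∈ , a∈ , b∈ = dense-es (select (in-trace? true W)) (select (in-trace? false W))
                                  (≤-trans (large true) (∣part∣≤∣trace∣ true W))
                                  (≤-trans (large false) (∣part∣≤∣trace∣ false W))
    in arm true a , arm false b , ∈-select⁻ (in-trace? true W) a∈ , ∈-select⁻ (in-trace? false W) b∈ ,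
       -- The `true` copy carries the smaller labels, so the listed pairs are ascending, as
       -- `graphOf` demands.
       inj₁ (<-≤-trans (subst (_< N) (sym (Fin.toℕ-↑ˡ a N)) (Fin.toℕ<n a))
                       (≤-trans (m≤m+n N (toℕ b)) (≤-reflexive (sym (Fin.toℕ-↑ʳ N b)))) ,
             Mem.∈-map⁺ _ ab∈)

-- Numerical estimates

≤maximum : ∀ {t} (ns : Fin t → ℕ) i → ns i ≤ maximum ns
≤maximum ns zero    = m≤m⊔n (ns zero) _
≤maximum ns (suc i) = ≤-trans (≤maximum (ns ∘ suc) i) (m≤n⊔m (ns zero) _)

n≤2^n : ∀ n → n ≤ 2 ^ n
n≤2^n zero    = z≤n
n≤2^n (suc n) = ≤-trans (+-mono-≤ (m^n>0 2 n) (n≤2^n n)) (≤-reflexive (cong (2 ^ n +_) (sym (+-identityʳ (2 ^ n)))))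

log-radius : ∀ m → 1 ≤ m → ∃[ d ] ((∀ {i} → i < d → 2 ^ i ≤ m) × m ≤ 2 ^ d × 2 ^ d ≤ 2 * m)
log-radius m 1≤m with least (λ d → m ≤? 2 ^ d) m (n≤2^n m)
... | d , _ , m≤2^d , minimal = d , below , m≤2^d , above d below
  where
  below : ∀ {i} → i < d → 2 ^ i ≤ m
  below {i} i<d = <⇒≤ (≰⇒> λ m≤2^i → <⇒≱ i<d (minimal i m≤2^i))
  above : ∀ d → (∀ {i} → i < d → 2 ^ i ≤ m) → 2 ^ d ≤ 2 * m
  above zero    _     = ≤-trans 1≤m (m≤m+n m _)
  above (suc d) below = *-monoʳ-≤ 2 (below ≤-refl)

-- Minimality of the radius gives 2^(d+1) ≤ 4 m ≤ x, so d + 1 is at most the rounded logarithm and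
-- hence less than `k`. The k - (d + 1) pairs left over form the path.
log-fits : ∀ {m x k} → 1 ≤ m → 4 * m ≤ x → k ≤ m → 2 * ⌈log₂ x ⌉ + 2 ≤ k * 2 → Fits m (k * 2)
log-fits {m} {x} {k} 1≤m 4m≤x k≤m log≤ with log-radius m 1≤m
... | d , below , m≤2^d , 2^d≤2m = fits d (k ∸ suc d) below m≤2^d (m<n⇒0<n∸m 1+d<k)
        (≤-trans (m∸n≤m k (suc d)) k≤m)
        (trans (double (suc d) (k ∸ suc d)) (cong (_* 2) (m+[n∸m]≡n (<⇒≤ 1+d<k))))
  where
  double : ∀ a b → a + (a + (b + b)) ≡ (a + b) * 2
  double = solve-∀
  1+d≤log : suc d ≤ ⌈log₂ x ⌉
  1+d≤log = subst (_≤ ⌈log₂ x ⌉) (⌈log₂2^n⌉≡n (suc d))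
    (⌈log₂⌉-mono-≤ (≤-trans (*-monoʳ-≤ 2 2^d≤2m) (≤-trans (≤-reflexive (sym (*-assoc 2 2 m))) 4m≤x)))
  1+d<k : suc d < k
  1+d<k = *-cancelˡ-≤ 2 (begin
    2 * suc (suc d)        ≤⟨ *-monoʳ-≤ 2 (s≤s 1+d≤log) ⟩
    2 * suc ⌈log₂ x ⌉      ≡⟨ *-suc 2 ⌈log₂ x ⌉ ⟩
    2 + 2 * ⌈log₂ x ⌉      ≡⟨ +-comm 2 (2 * ⌈log₂ x ⌉) ⟩
    2 * ⌈log₂ x ⌉ + 2      ≤⟨ log≤ ⟩
    k * 2                  ≡⟨ *-comm k 2 ⟩
    2 * k                  ∎)
    where open ≤-Reasoning

-- Rounding 40 up to 64 = 2^6 turns the number of pairs of subsets into a power of 2; the final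
-- `suc` makes the inequality strict.
pairs<2^ : ∀ t m → (4 * 40 ^ t) ^ m * (4 * 40 ^ t) ^ m < 2 ^ suc ((2 + 6 * t) * (m + m))
pairs<2^ t m = begin-strict
  (4 * 40 ^ t) ^ m * (4 * 40 ^ t) ^ m    ≡⟨ sym (^-distribˡ-+-* (4 * 40 ^ t) m m) ⟩
  (4 * 40 ^ t) ^ (m + m)                 ≤⟨ ^-monoˡ-≤ (m + m) (*-monoʳ-≤ 4 (^-monoˡ-≤ t (m≤m+n 40 24))) ⟩
  (4 * 64 ^ t) ^ (m + m)                 ≡⟨ cong (λ a → (4 * a) ^ (m + m)) (^-*-assoc 2 6 t) ⟩
  (4 * 2 ^ (6 * t)) ^ (m + m)            ≡⟨ cong (_^ (m + m)) (sym (^-distribˡ-+-* 2 2 (6 * t))) ⟩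
  (2 ^ (2 + 6 * t)) ^ (m + m)            ≡⟨ ^-*-assoc 2 (2 + 6 * t) (m + m) ⟩
  2 ^ ((2 + 6 * t) * (m + m))            <⟨ ^-monoʳ-< 2 ≤-refl (n<1+n ((2 + 6 * t) * (m + m))) ⟩
  2 ^ suc ((2 + 6 * t) * (m + m))        ∎
  where open ≤-Reasoning

-- Here 1600 = 40² and 6561 = 81². From one t to the next the linear factor at most doubles, and 2 *
-- 1600 ≤ 6561.
growth : ∀ t → (96 * suc t + 33) * 1600 ^ suc t ≤ 32 * 6561 ^ suc t
growth zero    = m≤m+n 206400 3552
growth (suc t) = begin
  (96 * suc (suc t) + 33) * (1600 * 1600 ^ suc t)    ≤⟨ *-monoˡ-≤ _ (ratio t) ⟩
  2 * (96 * suc t + 33) * (1600 * 1600 ^ suc t)      ≡⟨ reorder 2 (96 * suc t + 33) 1600 (1600 ^ suc t) ⟩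
  2 * 1600 * ((96 * suc t + 33) * 1600 ^ suc t)      ≤⟨ *-mono-≤ (m≤m+n 3200 3361) (growth t) ⟩
  6561 * (32 * 6561 ^ suc t)                         ≡⟨ *-exchange 6561 32 (6561 ^ suc t) ⟩
  32 * 6561 ^ suc (suc t)                            ∎
  where
  open ≤-Reasoning
  reorder : ∀ a b c d → a * b * (c * d) ≡ a * c * (b * d)
  reorder = solve-∀
  double : ∀ t → 96 * (2 + t) + 33 + (96 * t + 33) ≡ 2 * (96 * (1 + t) + 33)
  double = solve-∀
  ratio : ∀ t → 96 * suc (suc t) + 33 ≤ 2 * (96 * suc t + 33)
  ratio t = ≤-trans (m≤m+n _ (96 * t + 33)) (≤-reflexive (double t))

-- After scaling by 16, the summand 1 in the exponent contributes 16 ≤ n and raises the coefficient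
-- 96 t + 32 to 96 t + 33. This is where the threshold 16 is used.
edges≤ : ∀ t n m → 1 ≤ t → 16 ≤ n → m + m ≤ n →
         40 ^ t * 40 ^ t * suc ((2 + 6 * t) * (m + m)) ≤ 2 * 81 ^ (2 * t) * n
edges≤ (suc t) n m 1≤t 16≤n 2m≤n = *-cancelˡ-≤ 16 (begin
  16 * (40 ^ suc t * 40 ^ suc t * suc ((2 + 6 * suc t) * (m + m)))
    ≤⟨ *-monoʳ-≤ 16 (*-monoʳ-≤ (40 ^ suc t * 40 ^ suc t) (s≤s (*-monoʳ-≤ (2 + 6 * suc t) 2m≤n))) ⟩
  16 * (40 ^ suc t * 40 ^ suc t * suc ((2 + 6 * suc t) * n))
    ≡⟨ cong (λ a → 16 * (a * suc ((2 + 6 * suc t) * n))) (sym (*-^-distrib 40 40 (suc t))) ⟩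
  16 * (1600 ^ suc t * suc ((2 + 6 * suc t) * n))
    ≡⟨ expand (1600 ^ suc t) t n ⟩
  1600 ^ suc t * (16 + (96 * suc t + 32) * n)
    ≤⟨ *-monoʳ-≤ (1600 ^ suc t) (+-monoˡ-≤ _ 16≤n) ⟩
  1600 ^ suc t * (n + (96 * suc t + 32) * n)
    ≡⟨ collect (1600 ^ suc t) t n ⟩
  (96 * suc t + 33) * 1600 ^ suc t * n
    ≤⟨ *-monoˡ-≤ n (growth t) ⟩
  32 * 6561 ^ suc t * n
    ≡⟨ cong (λ a → 32 * a * n) (^-*-assoc 81 2 (suc t)) ⟩
  32 * 81 ^ (2 * suc t) * n
    ≡⟨ factor (81 ^ (2 * suc t)) n ⟩
  16 * (2 * 81 ^ (2 * suc t) * n) ∎)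
  where
  open ≤-Reasoning
  expand : ∀ a t n → 16 * (a * (1 + (2 + 6 * (1 + t)) * n)) ≡ a * (16 + (96 * (1 + t) + 32) * n)
  expand = solve-∀
  collect : ∀ a t n → a * (n + (96 * (1 + t) + 32) * n) ≡ (96 * (1 + t) + 33) * a * n
  collect = solve-∀
  factor : ∀ a n → 32 * a * n ≡ 16 * (2 * a * n)
  factor = solve-∀

-- Passage to rational numbers

fromℕ-mono : ∀ {a b} → a ≤ b → fromℕ a ℚ.≤ fromℕ b
fromℕ-mono {a} {b} a≤b = ℚ.toℚᵘ-cancel-≤ (begin
  ℚ.toℚᵘ (fromℕ a)          ≃⟨ ℚ.toℚᵘ-fromℚᵘ (ℚᵘ.mkℚᵘ (ℤ.+ a) 0) ⟩
  ℚᵘ.mkℚᵘ (ℤ.+ a) 0         ≤⟨ ℚᵘ.*≤* (ℤ.*-monoʳ-≤-nonNeg (ℤ.+ 1) (ℤ.+≤+ a≤b)) ⟩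
  ℚᵘ.mkℚᵘ (ℤ.+ b) 0         ≃⟨ ℚᵘ.≃-sym (ℚ.toℚᵘ-fromℚᵘ (ℚᵘ.mkℚᵘ (ℤ.+ b) 0)) ⟩
  ℚ.toℚᵘ (fromℕ b)          ∎)
  where open ℚᵘ.≤-Reasoning

fromℕ-* : ∀ a b → fromℕ (a * b) ≡ fromℕ a ℚ.* fromℕ b
fromℕ-* a b = ℚ.toℚᵘ-injective (begin-equality
  ℚ.toℚᵘ (fromℕ (a * b))                      ≃⟨ ℚ.toℚᵘ-fromℚᵘ (ℚᵘ.mkℚᵘ (ℤ.+ (a * b)) 0) ⟩
  ℚᵘ.mkℚᵘ (ℤ.+ (a * b)) 0                     ≃⟨ ℚᵘ.*≡* (cong (ℤ._* ℤ.+ 1) (ℤ.pos-* a b)) ⟩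
  ℚᵘ.mkℚᵘ (ℤ.+ a) 0 ℚᵘ.* ℚᵘ.mkℚᵘ (ℤ.+ b) 0
    ≃⟨ ℚᵘ.≃-sym (ℚᵘ.*-cong (ℚ.toℚᵘ-fromℚᵘ (ℚᵘ.mkℚᵘ (ℤ.+ a) 0)) (ℚ.toℚᵘ-fromℚᵘ (ℚᵘ.mkℚᵘ (ℤ.+ b) 0))) ⟩
  ℚ.toℚᵘ (fromℕ a) ℚᵘ.* ℚ.toℚᵘ (fromℕ b)      ≃⟨ ℚᵘ.≃-sym (ℚ.toℚᵘ-homo-* (fromℕ a) (fromℕ b)) ⟩
  ℚ.toℚᵘ (fromℕ a ℚ.* fromℕ b)                ∎)
  where open ℚᵘ.≤-Reasoning

fromℕ-nonNeg : ∀ a → ℚ.NonNegative (fromℕ a)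
fromℕ-nonNeg a = ℚ.normalize-nonNeg a 1

0≤upperSum : ∀ a M → ℚ.0ℚ ℚ.≤ upperSum a M
0≤upperSum a M = go (upTo ((a ∸ 1) * suc M))
  where
  go : ∀ js → ℚ.0ℚ ℚ.≤ List.foldr ℚ._+_ ℚ.0ℚ (List.map (λ j → (ℤ.+ 1) ℚ./ suc (M + j)) js)
  go []       = ℚ.≤-refl
  go (j ∷ js) = ℚ.+-mono-≤ (ℚ.nonNegative⁻¹ ((ℤ.+ 1) ℚ./ suc (M + j)) {{ℚ.normalize-nonNeg 1 (suc (M + j))}}) (go js)

bound-in-ℚ : ∀ {m B t n q} → m ≤ B * n → ℚ.0ℚ ℚ.≤ q →
             fromℕ m ℚ.≤ fromℕ B ℚ.* (fromℕ t ℚ.* q ℚ.+ ℚ.1ℚ) ℚ.* fromℕ n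
bound-in-ℚ {m} {B} {t} {n} {q} m≤ 0≤q = begin
  fromℕ m                                                   ≤⟨ fromℕ-mono m≤ ⟩
  fromℕ (B * n)                                             ≡⟨ fromℕ-* B n ⟩
  fromℕ B ℚ.* fromℕ n                                       ≡⟨ cong (ℚ._* fromℕ n) (sym (ℚ.*-identityʳ (fromℕ B))) ⟩
  fromℕ B ℚ.* ℚ.1ℚ ℚ.* fromℕ n
    ≤⟨ ℚ.*-monoʳ-≤-nonNeg (fromℕ n) {{fromℕ-nonNeg n}}
         (ℚ.*-monoˡ-≤-nonNeg (fromℕ B) {{fromℕ-nonNeg B}} 1≤tq+1) ⟩
  fromℕ B ℚ.* (fromℕ t ℚ.* q ℚ.+ ℚ.1ℚ) ℚ.* fromℕ n          ∎
  where
  open ℚ.≤-Reasoning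
  0≤tq : ℚ.0ℚ ℚ.≤ fromℕ t ℚ.* q
  0≤tq = ℚ.nonNegative⁻¹ (fromℕ t ℚ.* q) {{ℚ.nonNeg*nonNeg⇒nonNeg (fromℕ t) {{fromℕ-nonNeg t}} q {{ℚ.nonNegative 0≤q}}}}
  1≤tq+1 : ℚ.1ℚ ℚ.≤ fromℕ t ℚ.* q ℚ.+ ℚ.1ℚ
  1≤tq+1 = subst (ℚ._≤ fromℕ t ℚ.* q ℚ.+ ℚ.1ℚ) (ℚ.+-identityˡ ℚ.1ℚ) (ℚ.+-monoˡ-≤ ℚ.1ℚ 0≤tq)

even-cycles-fit : ∀ {t n m₀} m k → 1 ≤ m₀ → m₀ ≤ n → k ≤ m₀ → 2 * ⌈log₂ (81 ^ t * n) ⌉ + 2 ≤ k * 2 →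
                  m₀ ≤ m → 40 * m ≤ 40 ^ t * m₀ → Fits m (k * 2)
even-cycles-fit {t} {n} {m₀} m k 1≤m₀ m₀≤n k≤m₀ log≤ m₀≤m 40m≤ =
  log-fits (≤-trans 1≤m₀ m₀≤m) 4m≤ (≤-trans k≤m₀ m₀≤m) log≤
  where
  open ≤-Reasoning
  4m≤ : 4 * m ≤ 81 ^ t * n
  4m≤ = begin
    4 * m          ≤⟨ *-monoˡ-≤ m (m≤m+n 4 36) ⟩
    40 * m         ≤⟨ 40m≤ ⟩
    40 ^ t * m₀    ≤⟨ *-mono-≤ (^-monoˡ-≤ t (m≤m+n 40 41)) m₀≤n ⟩
    81 ^ t * n     ∎

arrow-with-few-edges : ∀ t (ns : Fin (suc t) → ℕ) → let n = maximum ns in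
  (∀ i → 2 ∣ ns i) → (∀ i → 2 * ⌈log₂ (81 ^ suc t * n) ⌉ + 2 ≤ ns i) → 16 ≤ n →
  ∃[ H ] ((H ⟶ (λ i → cycle (ns i))) × Graph.size H ≤ 2 * 81 ^ (2 * suc t) * n)
arrow-with-few-edges t ns 2∣ns log≤ 16≤n = build
  (dense-bipartite j m₀ e {{m*n≢0 20 (40 ^ t) {{_}} {{m^n≢0 40 t}}}} {{>-nonZero 1≤m₀}}
    (subst (λ K → (4 * K) ^ m₀ * (4 * K) ^ m₀ < 2 ^ e) (sym K≡) (pairs<2^ (suc t) m₀)))
  where
  n′ = maximum ns
  m₀ = ⌊ n′ /2⌋
  -- Half of 40^(t+1), since `dense-bipartite` takes an even ratio 2 * j.
  j = 20 * 40 ^ t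
  N = 2 * j * m₀
  e = suc ((2 + 6 * suc t) * (m₀ + m₀))

  K≡ : 2 * j ≡ 40 ^ suc t
  K≡ = sym (*-assoc 2 20 (40 ^ t))

  1≤m₀ : 1 ≤ m₀
  1≤m₀ = ≤-trans (s≤s z≤n) (⌊n/2⌋-mono 16≤n)

  2m₀≤n : m₀ + m₀ ≤ n′
  2m₀≤n = ≤-trans (+-monoʳ-≤ m₀ (⌊n/2⌋≤⌈n/2⌉ n′)) (≤-reflexive (⌊n/2⌋+⌈n/2⌉≡n n′))

  half≤m₀ : ∀ {i k} → ns i ≡ k * 2 → k ≤ m₀
  half≤m₀ {i} {k} eq = begin
    k                  ≡⟨ n≡⌊n+n/2⌋ k ⟩
    ⌊ k + k /2⌋        ≡⟨ cong ⌊_/2⌋ (k+k≡k*2 k) ⟩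
    ⌊ k * 2 /2⌋        ≡⟨ cong ⌊_/2⌋ (sym eq) ⟩
    ⌊ ns i /2⌋         ≤⟨ ⌊n/2⌋-mono (≤maximum ns i) ⟩
    m₀                 ∎
    where
    open ≤-Reasoning
    k+k≡k*2 : ∀ k → k + k ≡ k * 2
    k+k≡k*2 = solve-∀

  fit : ∀ i m → m₀ ≤ m → 40 * m ≤ 40 ^ suc t * m₀ → Fits m (ns i)
  fit i m m₀≤m 40m≤ with 2∣ns i
  ... | divides k eq = subst (Fits m) (sym eq)
    (even-cycles-fit {suc t} {n′} m k 1≤m₀ (≤-trans (m≤m+n m₀ m₀) 2m₀≤n) (half≤m₀ eq)
      (subst (2 * ⌈log₂ (81 ^ suc t * n′) ⌉ + 2 ≤_) eq (log≤ i)) m₀≤m 40m≤)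

  build : ∃ (λ (es : List (Fin N × Fin N)) → length es ≤ 2 * j * (2 * j) * e ×
            (∀ X Y → m₀ ≤ ∣ X ∣ → m₀ ≤ ∣ Y ∣ → ∃₂ λ a b → (a , b) ∈ᴸ es × a ∈ X × b ∈ Y)) →
          ∃[ H ] ((H ⟶ (λ i → cycle (ns i))) × Graph.size H ≤ 2 * 81 ^ (2 * suc t) * n′)
  build (es , len , dense-es) = H ,
    bipartite-arrow H side adj-cross ns 1≤m₀
      (λ b → ≤-trans (≤-reflexive (cong (_* m₀) (sym K≡))) (∣full-part∣ b)) (dense dense-es) fit ,
    ≤-trans size-H (≤-trans len
      (subst (λ K → K * K * e ≤ 2 * 81 ^ (2 * suc t) * n′) (sym K≡) (edges≤ (suc t) n′ m₀ (s≤s z≤n) 16≤n 2m₀≤n)))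
    where open Bipartite N es

theorem3p6 : ∀ (t : ℕ) → 1 ≤ t →
    ∃[ n₀ ] (∀ (ns : Fin t → ℕ) → let n = maximum ns in
    (∀ i → 1 ≤ ns i) →
    (∀ i → 2 ∣ ns i) →
    (∀ i → 2 * ⌈log₂ (81 ^ t * n) ⌉ + 2 ≤ ns i) →
    n₀ ≤ n →
    ∃[ m ] (IsSizeRamsey (λ i → cycle (ns i)) m ×
    (∀ (q : ℚ) → ln 81 < q →
    fromℕ m ℚ.≤ fromℕ (2 * 81 ^ (2 * t)) ℚ.* (fromℕ t ℚ.* q ℚ.+ ℚ.1ℚ) ℚ.* fromℕ n)))
theorem3p6 (suc t) _ = 16 , λ ns _ 2∣ns log≤ 16≤n → finish ns log≤ (arrow-with-few-edges t ns 2∣ns log≤ 16≤n)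
  where
  finish : ∀ ns → let n = maximum ns in (∀ i → 2 * ⌈log₂ (81 ^ suc t * n) ⌉ + 2 ≤ ns i) →
    ∃[ H ] ((H ⟶ (λ i → cycle (ns i))) × Graph.size H ≤ 2 * 81 ^ (2 * suc t) * n) →
    ∃[ m ] (IsSizeRamsey (λ i → cycle (ns i)) m × (∀ (q : ℚ) → ln 81 < q →
      fromℕ m ℚ.≤ fromℕ (2 * 81 ^ (2 * suc t)) ℚ.* (fromℕ (suc t) ℚ.* q ℚ.+ ℚ.1ℚ) ℚ.* fromℕ n))
  finish ns log≤ (H , arrow , size≤) =
    -- The summand 2 in the lower bound on the lengths ensures that no cycle has an isolated vertex.
    let m , ramsey , m≤ = size-Ramsey-exists (λ i → cycle (ns i))
                            (λ i → cycle-no-isolated (≤-trans (m≤n+m 2 _) (log≤ i))) H arrow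
    in m , ramsey , λ { q (M , <q) →
         bound-in-ℚ {B = 2 * 81 ^ (2 * suc t)} {t = suc t} (≤-trans m≤ size≤)
           (ℚ.≤-trans (0≤upperSum 81 M) (ℚ.<⇒≤ <q)) }
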